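{- Let $R$ be a ring in which $2$ is a unit, and assume $\operatorname{rank}(\mathbf{V})\geq 3$. Let $\tau\in\mathbf{M}_{\mathrm{stab}}(R)$ and $a\in\mathbf{G}(R)$. Suppose that $\mathbf{X}_{\tau,a}=\mathbf{H}_{\tau_H}$ as schemes over $R$, i.e. $\mathbf{X}_{\tau,a}(R')=\mathbf{H}_{\tau_H}(R')$ for every $R$-algebra $R'$. Then $a\in\mathbf{H}(R)\mathbf{Z}(R)$.
   Context: Rings are commutative with $1$. Let $\mathbf{V}$ be a free $\mathbb{Z}$-module of finite rank and $\mathbf{V}^*=\mathrm{Hom}(\mathbf{V},\mathbb{Z})$. Fix $e\in\mathbf{V}$, $e^*\in\mathbf{V}^*$ with $e^*(e)=1$. For a ring $R$ put $\mathbf{V}(R)=\mathbf{V}\otimes R$, $\mathbf{V}^*(R)=\mathbf{V}^*\otimes R=\mathrm{Hom}_R(\mathbf{V}(R),R)$, $\mathbf{M}(R)=\mathrm{End}_R(\mathbf{V}(R))$, $\mathbf{G}(R)=\mathrm{Aut}_R(\mathbf{V}(R))$, $\mathbf{Z}(R)=R^\times\subseteq\mathbf{G}(R)$ (scalar operators). Juxtaposition denotes the natural operations: $\ell v=\ell(v)$, $xv=x(v)$, $\ell x=\ell\circ x$, and $v\ell\in\mathbf{M}(R)$ is $u\mapsto \ell(u)v$. Let $\mathbf{V}_H(R)=\{v: e^*v=0\}$, so $\mathbf{V}(R)=\mathbf{V}_H(R)\oplus Re$, and $1_H=1-ee^*$. Let $\mathbf{M}_H(R)=\mathrm{End}_R(\mathbf{V}_H(R))$,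 viewed inside $\mathbf{M}(R)$ by extending by $0$ on $Re$, and $\mathbf{H}(R)=\mathrm{Aut}_R(\mathbf{V}_H(R))$, viewed inside $\mathbf{G}(R)$ by acting trivially on $Re$ (so $\mathbf{H}(R)=\{g\in\mathbf{G}(R): ge=e,\ e^*g=e^*\}$). For $\tau\in\mathbf{M}(R)$ put $\tau_H=1_H\tau 1_H\in\mathbf{M}_H(R)$. For an $R$-algebra $R'$, $\mathbf{G}_\tau(R')$ is the centralizer of $\tau$ in $\mathbf{G}(R')$, and for $\sigma\in\mathbf{M}_H(R)$, $\mathbf{H}_\sigma(R')$ is the centralizer of $\sigma$ in $\mathbf{H}(R')$. A vector $v\in\mathbf{V}(R)$ is $\tau$-cyclic if $R[\tau]v=\mathbf{V}(R)$; $\ell\in\mathbf{V}^*(R)$ is $\tau$-cyclic if $\ell R[\tau]=\mathbf{V}^*(R)$. $\tau$ is stable if $e$ and $e^*$ are both $\tau$-cyclic; $\mathbf{M}_{\mathrm{stab}}(R)$ denotes the set of stable elements. For $\tau\in\mathbf{M}_{\mathrm{stab}}(R)$, $a\in\mathbf{G}(R)$ and an $R$-algebra $R'$, set $\mathbf{X}_{\tau,a}(R')=\{y\in\mathbf{H}_{\tau_H}(R'): ay\in\mathbf{H}(R')\mathbf{G}_\tau(R')\}$. -}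

module Defs where

open import Level using (Level; _⊔_)
open import Data.Nat using (ℕ; zero; suc)
open import Data.Fin as Fin using (Fin; zero; suc)
open import Data.Bool using (if_then_else_)
open import Relation.Nullary using (does)
open import Data.Integer as ℤ using (ℤ; +_; -[1+_])
open import Data.List using (List; []; _∷_)
open import Data.Product using (Σ; ∃; _×_; _,_)
open import Algebra.Bundles using (CommutativeRing)
open import Algebra.Morphism.Structures using (module RingMorphisms)

-- Integer data: V = ℤ^n with standard basis; e ∈ V, e* ∈ V* given by
-- coordinates, with e*(e) = 1.

ℤsum : ∀ {n} → (Fin n → ℤ) → ℤ
ℤsum {zero}  f = + 0
ℤsum {suc n} f = f zero ℤ.+ ℤsum (λ i → f (suc i))

ℤpair : ∀ {n} → (Fin n → ℤ) → (Fin n → ℤ) → ℤ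
ℤpair l v = ℤsum (λ i → l i ℤ.* v i)

module LinAlg {c ℓ : Level} (R : CommutativeRing c ℓ) (n : ℕ) where
  open CommutativeRing R using (Carrier; _≈_; _+_; _*_; -_; _-_; 0#; 1#)

  Vect : Set c
  Vect = Fin n → Carrier

  Covect : Set c
  Covect = Fin n → Carrier

  Mat : Set c           -- elements of M(R) = End_R(V(R)), (x v)_i = Σ_j x i j v_j
  Mat = Fin n → Fin n → Carrier

  Σ[_] : ∀ {m} → (Fin m → Carrier) → Carrier
  Σ[_] {zero}  f = 0#
  Σ[_] {suc m} f = f zero + Σ[ (λ i → f (suc i)) ]

  fromℤ : ℤ → Carrier
  fromℕ : ℕ → Carrier
  fromℕ zero    = 0#
  fromℕ (suc k) = 1# + fromℕ k
  fromℤ (+ k)     = fromℕ k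
  fromℤ -[1+ k ]  = - (1# + fromℕ k)

  _≈ᵛ_ : Vect → Vect → Set ℓ
  v ≈ᵛ w = ∀ i → v i ≈ w i

  _≈ᴹ_ : Mat → Mat → Set ℓ
  x ≈ᴹ y = ∀ i j → x i j ≈ y i j

  _·_ : Mat → Mat → Mat
  (x · y) i j = Σ[ (λ k → x i k * y k j) ]

  _▹_ : Mat → Vect → Vect
  (x ▹ v) i = Σ[ (λ j → x i j * v j) ]

  _◃_ : Covect → Mat → Covect
  (l ◃ x) j = Σ[ (λ i → l i * x i j) ]

  ⟪_,_⟫ : Covect → Vect → Carrier
  ⟪ l , v ⟫ = Σ[ (λ i → l i * v i) ]

  _⊗_ : Vect → Covect → Mat
  (v ⊗ l) i j = v i * l j

  1ᴹ : Mat
  1ᴹ i j = if does (i Fin.≟ j) then 1# else 0#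

  _-ᴹ_ : Mat → Mat → Mat
  (x -ᴹ y) i j = x i j - y i j

  scal : Carrier → Mat
  scal u i j = u * 1ᴹ i j

  _·ᵛ_ : Carrier → Vect → Vect
  (r ·ᵛ v) i = r * v i

  _+ᵛ_ : Vect → Vect → Vect
  (v +ᵛ w) i = v i + w i

  0ᵛ : Vect
  0ᵛ i = 0#

  -- p(τ) v for p = c₀ + c₁ X + … given by its coefficient list
  polyAct : List Carrier → Mat → Vect → Vect
  polyAct []       τ v = 0ᵛ
  polyAct (a ∷ cs) τ v = (a ·ᵛ v) +ᵛ polyAct cs τ (τ ▹ v)

  polyActL : List Carrier → Covect → Mat → Covect
  polyActL []       l τ = 0ᵛ
  polyActL (a ∷ cs) l τ = (a ·ᵛ l) +ᵛ polyActL cs (l ◃ τ) τ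

  CyclicVec : Mat → Vect → Set (c ⊔ ℓ)
  CyclicVec τ v = ∀ (w : Vect) → ∃ λ (p : List Carrier) → polyAct p τ v ≈ᵛ w

  CyclicCovec : Mat → Covect → Set (c ⊔ ℓ)
  CyclicCovec τ l = ∀ (m : Covect) → ∃ λ (p : List Carrier) → polyActL p l τ ≈ᵛ m

  IsUnit : Carrier → Set (c ⊔ ℓ)
  IsUnit u = ∃ λ w → u * w ≈ 1#

  InG : Mat → Set (c ⊔ ℓ)
  InG g = ∃ λ h → ((g · h) ≈ᴹ 1ᴹ) × ((h · g) ≈ᴹ 1ᴹ)

  InZ : Mat → Set (c ⊔ ℓ)
  InZ z = ∃ λ u → IsUnit u × (z ≈ᴹ scal u)

  InGcent : Mat → Mat → Set (c ⊔ ℓ)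
  InGcent τ g = InG g × ((g · τ) ≈ᴹ (τ · g))

  module WithE (e : Fin n → ℤ) (e* : Fin n → ℤ) where
    eR : Vect
    eR i = fromℤ (e i)

    e*R : Covect
    e*R i = fromℤ (e* i)

    1H : Mat
    1H = 1ᴹ -ᴹ (eR ⊗ e*R)

    _ᴴ : Mat → Mat
    τ ᴴ = (1H · τ) · 1H

    Stable : Mat → Set (c ⊔ ℓ)
    Stable τ = CyclicVec τ eR × CyclicCovec τ e*R

    InH : Mat → Set (c ⊔ ℓ)
    InH g = InG g × ((g ▹ eR) ≈ᵛ eR) × ((e*R ◃ g) ≈ᵛ e*R)

    InHcent : Mat → Mat → Set (c ⊔ ℓ)
    InHcent σ y = InH y × ((y · σ) ≈ᴹ (σ · y))

    InHZ : Mat → Set (c ⊔ ℓ)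
    InHZ g = ∃ λ h → ∃ λ z → InH h × InZ z × (g ≈ᴹ (h · z))

    InHGτ : Mat → Mat → Set (c ⊔ ℓ)
    InHGτ τ g = ∃ λ h → ∃ λ k → InH h × InGcent τ k × (g ≈ᴹ (h · k))

    InX : Mat → Mat → Mat → Set (c ⊔ ℓ)
    InX τ a y = InHcent (τ ᴴ) y × InHGτ τ (a · y)

record Algebra {c ℓ : Level} (R : CommutativeRing c ℓ) (c' ℓ' : Level)
       : Set (c ⊔ ℓ ⊔ Level.suc (c' ⊔ ℓ')) where
  field
    ring : CommutativeRing c' ℓ'
    φ    : CommutativeRing.Carrier R → CommutativeRing.Carrier ring
    isHom : RingMorphisms.IsRingHomomorphism
              (CommutativeRing.rawRing R) (CommutativeRing.rawRing ring) φ

baseMat : ∀ {c ℓ c' ℓ'} {R : CommutativeRing c ℓ} {n : ℕ} (A : Algebra R c' ℓ') →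
          LinAlg.Mat R n → LinAlg.Mat (Algebra.ring A) n
baseMat A x i j = Algebra.φ A (x i j)

{-# OPTIONS --safe #-}
-- Put ℓ = e*a and v = a⁻¹e. A point y of H_σ, σ = τ_H, lies in X exactly when some k ∈ G_τ satisfies
-- e*k = ℓy and k⁻¹e = y⁻¹v. Over R[[ε]] take y = 1 − εη with η ∈ M_H commuting with σ: since e* is
-- τ-cyclic, k = k₀ + εk₁, and the coefficients of k⁻¹e give s in the centralizer of τ with
-- ηᵐ⁺¹v = sηᵐv for all m and ℓs = ℓη. For y = 1 one gets t with e*t = ℓ, t⁻¹e = v.
-- With η = 1_H, α = e*v and β = ℓe this gives αt = βt⁻¹ = αβ, with 1 − αβ =: p idempotent and
-- pα = pβ = 0. With η = σ it gives ps = pτ − γt for some γ = pγ, and further γτ = γθ + γ²t and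
-- γt² ∈ R, so γ²τ² ∈ γ²(Rτ + R). As τ is cyclic and the rank is at least 3, γ² = 0, and then γ = 0
-- in the same way. So pσᵐv = pτᵐv and p e*τᵐv = 0 for all m; as v is τ-cyclic, p = p e*e = 0.
-- Hence αβ = 1 and t = β is a scalar.
module Submission where

open import Defs
open import Level using (Level; _⊔_)
open import Data.Nat as ℕ using (ℕ; zero; suc; _≥_; s≤s)
import Data.Nat.Properties as ℕ
open import Data.Fin as Fin using (Fin; zero; suc)
open import Data.Fin.Patterns using (0F; 1F; 2F)
open import Data.Integer as ℤ using (ℤ; +_; -[1+_]; _⊖_)
import Data.Integer.Properties as ℤ
open import Data.List using (List; []; _∷_)
open import Data.Bool using (true; false; if_then_else_)
open import Data.Product using (∃; _×_; _,_; proj₁; proj₂)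
open import Function.Bundles using (_⇔_; Equivalence)
open import Relation.Nullary using (does)
open import Relation.Binary.Bundles using (Setoid)
open import Relation.Binary.Structures using (IsEquivalence)
open import Relation.Binary.PropositionalEquality as ≡ using (_≡_)
open import Algebra.Bundles using (CommutativeRing; CommutativeSemiring)
open import Algebra.Definitions using (Congruent₂; Commutative; Associative; LeftCancellative)
open import Algebra.Morphism.Structures using (module RingMorphisms)
open import Algebra.Structures.Biased using (IsCommutativeSemiringˡ; IsCommutativeMonoidˡ)
import Algebra.Construct.Pointwise
import Algebra.Morphism.Construct.Identity
import Algebra.Properties.CommutativeSemigroup
import Algebra.Properties.Ring
import Algebra.Properties.Semiring.Sum
import Algebra.Solver.Ring.NaturalCoefficients.Default
import Relation.Binary.Reasoning.Setoid

-- Dual numbers would yield only `ηv = sv`, while the last step needs `σᵐv` for every m. Over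
-- `R[[ε]]` the operator `1 − εη` is invertible whatever η is, and each coefficient of its inverse
-- contributes an equation. A single s governs all of them because k is linear in ε, so that the
-- coefficients of its inverse obey a one-step recursion. The choices `1H` and σ for η are the
-- evident elements of M_H that commute with σ. R may have zero divisors and nilpotents. Multipliers
-- such as p and γ therefore stay in front of the equations instead of being divided out, and the
-- clash between a quadratic relation for τ and rank at least 3 is expressed by minors. Nilpotents
-- are also why γ is killed in two rounds: the quadratic relation holds only after multiplication by
-- γ², and `γ² = 0` alone does not give `γ = 0`; but it removes the term in t and leaves the
-- relation `γτ = γθ` of degree one.

-- Finite sums and the algebra of matrices, vectors and covectors.

module MatrixProperties {c ℓ : Level} (R : CommutativeRing c ℓ) (n : ℕ) where
  open CommutativeRing R hiding (zero)
  open LinAlg R n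
  open Algebra.Properties.Ring ring using (+-inverseˡ-unique)
  open Algebra.Properties.CommutativeSemigroup *-commutativeSemigroup using (x∙yz≈y∙xz)
  private module S = Algebra.Properties.Semiring.Sum semiring
  open Relation.Binary.Reasoning.Setoid setoid

  -- Both sums recurse in the same way, so the equality is propositional and the laws of finite sums
  -- transfer by rewriting.
  Σ≡sum : ∀ {m} (f : Fin m → Carrier) → Σ[ f ] ≡ S.sum f
  Σ≡sum {zero}  f = ≡.refl
  Σ≡sum {suc m} f = ≡.cong (λ u → f zero + u) (Σ≡sum (λ i → f (suc i)))

  Σ-cong : ∀ {m} {f g : Fin m → Carrier} → (∀ i → f i ≈ g i) → Σ[ f ] ≈ Σ[ g ]
  Σ-cong {f = f} {g} p rewrite Σ≡sum f | Σ≡sum g = S.sum-cong-≋ p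

  Σ-+ : ∀ {m} (f g : Fin m → Carrier) → Σ[ (λ i → f i + g i) ] ≈ Σ[ f ] + Σ[ g ]
  Σ-+ f g rewrite Σ≡sum f | Σ≡sum g | Σ≡sum (λ i → f i + g i) = S.∑-distrib-+ f g

  *-Σ : ∀ {m} u (f : Fin m → Carrier) → u * Σ[ f ] ≈ Σ[ (λ i → u * f i) ]
  *-Σ u f rewrite Σ≡sum f | Σ≡sum (λ i → u * f i) = S.*-distribˡ-sum u f

  Σ-* : ∀ {m} (f : Fin m → Carrier) u → Σ[ f ] * u ≈ Σ[ (λ i → f i * u) ]
  Σ-* f u rewrite Σ≡sum f | Σ≡sum (λ i → f i * u) = S.*-distribʳ-sum u f

  Σ-comm : ∀ {k m} (f : Fin k → Fin m → Carrier) →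
    Σ[ (λ i → Σ[ f i ]) ] ≈ Σ[ (λ j → Σ[ (λ i → f i j) ]) ]
  Σ-comm {k} {m} f = begin
    Σ[ (λ i → Σ[ f i ]) ]              ≈⟨ Σ-cong {k} (λ i → reflexive (Σ≡sum (f i))) ⟩
    Σ[ (λ i → S.sum (f i)) ]           ≡⟨ Σ≡sum {k} _ ⟩
    S.sum (λ i → S.sum (f i))          ≈⟨ S.∑-comm f ⟩
    S.sum (λ j → S.sum (λ i → f i j))  ≡⟨ Σ≡sum {m} _ ⟨
    Σ[ (λ j → S.sum (λ i → f i j)) ]   ≈⟨ Σ-cong {m} (λ j → reflexive (≡.sym (Σ≡sum {k} _))) ⟩
    Σ[ (λ j → Σ[ (λ i → f i j) ]) ]    ∎

  Σ-zero : ∀ {m} {f : Fin m → Carrier} → (∀ i → f i ≈ 0#) → Σ[ f ] ≈ 0#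
  Σ-zero {zero}  p = refl
  Σ-zero {suc m} p = trans (+-cong (p zero) (Σ-zero (λ i → p (suc i)))) (+-identityˡ 0#)

  Σ-δˡ : ∀ {m} (i : Fin m) (f : Fin m → Carrier) →
    Σ[ (λ j → (if does (i Fin.≟ j) then 1# else 0#) * f j) ] ≈ f i
  Σ-δˡ {suc m} zero    f = trans (+-cong (*-identityˡ _) (Σ-zero {m} λ _ → zeroˡ _)) (+-identityʳ _)
  Σ-δˡ (suc i) f = trans (+-cong (zeroˡ _) (Σ-δˡ i (λ j → f (suc j)))) (+-identityˡ _)

  Σ-δʳ : ∀ {m} (i : Fin m) (f : Fin m → Carrier) →
    Σ[ (λ j → f j * (if does (j Fin.≟ i) then 1# else 0#)) ] ≈ f i
  Σ-δʳ {suc m} zero    f = trans (+-cong (*-identityʳ _) (Σ-zero {m} λ _ → zeroʳ _)) (+-identityʳ _)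
  Σ-δʳ (suc i) f = trans (+-cong (zeroʳ _) (Σ-δʳ i (λ j → f (suc j)))) (+-identityˡ _)

  Σ-assoc : (l : Covect) (x : Mat) (v : Vect) → ⟪ l ◃ x , v ⟫ ≈ ⟪ l , x ▹ v ⟫
  Σ-assoc l x v = begin
    Σ[ (λ j → Σ[ (λ i → l i * x i j) ] * v j) ]    ≈⟨ Σ-cong {n} (λ j → Σ-* {n} _ (v j)) ⟩
    Σ[ (λ j → Σ[ (λ i → l i * x i j * v j) ]) ]    ≈⟨ Σ-comm {n} {n} _ ⟩
    Σ[ (λ i → Σ[ (λ j → l i * x i j * v j) ]) ]    ≈⟨ Σ-cong {n} (λ i → Σ-cong {n} (λ j → *-assoc _ _ _)) ⟩
    Σ[ (λ i → Σ[ (λ j → l i * (x i j * v j)) ]) ]  ≈⟨ Σ-cong {n} (λ i → *-Σ {n} (l i) _) ⟨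
    Σ[ (λ i → l i * Σ[ (λ j → x i j * v j) ]) ]    ∎

  Vect-setoid : Setoid c ℓ
  Vect-setoid = record
    { Carrier = Vect
    ; _≈_ = _≈ᵛ_
    ; isEquivalence = record
      { refl  = λ i → refl
      ; sym   = λ p i → sym (p i)
      ; trans = λ p q i → trans (p i) (q i)
      }
    }

  Mat-setoid : Setoid c ℓ
  Mat-setoid = record
    { Carrier = Mat
    ; _≈_ = _≈ᴹ_
    ; isEquivalence = record
      { refl  = λ i j → refl
      ; sym   = λ p i j → sym (p i j)
      ; trans = λ p q i j → trans (p i j) (q i j)
      }
    }

  open Setoid Vect-setoid public using () renaming (refl to ≈ᵛ-refl; sym to ≈ᵛ-sym; trans to ≈ᵛ-trans)
  open Setoid Mat-setoid public using () renaming (refl to ≈ᴹ-refl; sym to ≈ᴹ-sym; trans to ≈ᴹ-trans)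

  module Vect-Reasoning = Relation.Binary.Reasoning.Setoid Vect-setoid
  module Mat-Reasoning = Relation.Binary.Reasoning.Setoid Mat-setoid

  infixl 6 _+ᴹ_
  _+ᴹ_ : Mat → Mat → Mat
  (x +ᴹ y) i j = x i j + y i j

  0ᴹ : Mat
  0ᴹ i j = 0#

  -- Juxtapositions of matrices, vectors and covectors are all sums of the shape Σᵢ aᵢ bᵢ,
  -- so their laws are instances of the laws of ⟪_,_⟫.

  pair-cong : ∀ {l l′ v v′} → l ≈ᵛ l′ → v ≈ᵛ v′ → ⟪ l , v ⟫ ≈ ⟪ l′ , v′ ⟫
  pair-cong p q = Σ-cong {n} (λ i → *-cong (p i) (q i))

  pair-+ʳ : ∀ l v w → ⟪ l , v +ᵛ w ⟫ ≈ ⟪ l , v ⟫ + ⟪ l , w ⟫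
  pair-+ʳ l v w = trans (Σ-cong {n} (λ i → distribˡ _ _ _)) (Σ-+ {n} _ _)

  pair-+ˡ : ∀ l m v → ⟪ l +ᵛ m , v ⟫ ≈ ⟪ l , v ⟫ + ⟪ m , v ⟫
  pair-+ˡ l m v = trans (Σ-cong {n} (λ i → distribʳ _ _ _)) (Σ-+ {n} _ _)

  pair-·ʳ : ∀ l u v → ⟪ l , u ·ᵛ v ⟫ ≈ u * ⟪ l , v ⟫
  pair-·ʳ l u v = trans (Σ-cong {n} (λ i → x∙yz≈y∙xz _ _ _)) (sym (*-Σ {n} u _))

  pair-·ˡ : ∀ u l v → ⟪ u ·ᵛ l , v ⟫ ≈ u * ⟪ l , v ⟫
  pair-·ˡ u l v = trans (Σ-cong {n} (λ i → *-assoc _ _ _)) (sym (*-Σ {n} u _))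

  pair-0ʳ : ∀ l {v} → v ≈ᵛ 0ᵛ → ⟪ l , v ⟫ ≈ 0#
  pair-0ʳ l p = Σ-zero {n} (λ i → trans (*-congˡ (p i)) (zeroʳ _))

  pair-0ˡ : ∀ {l} v → l ≈ᵛ 0ᵛ → ⟪ l , v ⟫ ≈ 0#
  pair-0ˡ v p = Σ-zero {n} (λ i → trans (*-congʳ (p i)) (zeroˡ _))

  ·-cong : ∀ {x x′ y y′} → x ≈ᴹ x′ → y ≈ᴹ y′ → (x · y) ≈ᴹ (x′ · y′)
  ·-cong p q i j = pair-cong (p i) (λ k → q k j)

  ▹-cong : ∀ {x x′ v v′} → x ≈ᴹ x′ → v ≈ᵛ v′ → (x ▹ v) ≈ᵛ (x′ ▹ v′)
  ▹-cong p q i = pair-cong (p i) q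

  ◃-cong : ∀ {l l′ x x′} → l ≈ᵛ l′ → x ≈ᴹ x′ → (l ◃ x) ≈ᵛ (l′ ◃ x′)
  ◃-cong p q j = pair-cong p (λ i → q i j)

  ·-assoc : ∀ x y z → ((x · y) · z) ≈ᴹ (x · (y · z))
  ·-assoc x y z i j = Σ-assoc (x i) y (λ k → z k j)

  ▹-assoc : ∀ x y v → ((x · y) ▹ v) ≈ᵛ (x ▹ (y ▹ v))
  ▹-assoc x y v i = Σ-assoc (x i) y v

  ◃-assoc : ∀ l x y → ((l ◃ x) ◃ y) ≈ᵛ (l ◃ (x · y))
  ◃-assoc l x y j = Σ-assoc l x (λ k → y k j)

  ·-identityˡ : ∀ x → (1ᴹ · x) ≈ᴹ x
  ·-identityˡ x i j = Σ-δˡ i (λ k → x k j)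

  ·-identityʳ : ∀ x → (x · 1ᴹ) ≈ᴹ x
  ·-identityʳ x i j = Σ-δʳ j (x i)

  ▹-identity : ∀ v → (1ᴹ ▹ v) ≈ᵛ v
  ▹-identity v i = Σ-δˡ i v

  ◃-identity : ∀ l → (l ◃ 1ᴹ) ≈ᵛ l
  ◃-identity l j = Σ-δʳ j l

  ▹-+ : ∀ x v w → (x ▹ (v +ᵛ w)) ≈ᵛ ((x ▹ v) +ᵛ (x ▹ w))
  ▹-+ x v w i = pair-+ʳ (x i) v w

  ▹-·ᵛ : ∀ x u v → (x ▹ (u ·ᵛ v)) ≈ᵛ (u ·ᵛ (x ▹ v))
  ▹-·ᵛ x u v i = pair-·ʳ (x i) u v

  +-▹ : ∀ x y v → ((x +ᴹ y) ▹ v) ≈ᵛ ((x ▹ v) +ᵛ (y ▹ v))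
  +-▹ x y v i = pair-+ˡ (x i) (y i) v

  ◃-+ : ∀ l x y → (l ◃ (x +ᴹ y)) ≈ᵛ ((l ◃ x) +ᵛ (l ◃ y))
  ◃-+ l x y j = pair-+ʳ l (λ i → x i j) (λ i → y i j)

  ·-distribˡ : ∀ x y z → (x · (y +ᴹ z)) ≈ᴹ ((x · y) +ᴹ (x · z))
  ·-distribˡ x y z i j = pair-+ʳ (x i) (λ k → y k j) (λ k → z k j)

  ·-distribʳ : ∀ x y z → ((y +ᴹ z) · x) ≈ᴹ ((y · x) +ᴹ (z · x))
  ·-distribʳ x y z i j = pair-+ˡ (y i) (z i) (λ k → x k j)

  scal-▹ : ∀ u v → (scal u ▹ v) ≈ᵛ (u ·ᵛ v)
  scal-▹ u v i = trans (pair-·ˡ u (1ᴹ i) v) (*-congˡ (▹-identity v i))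

  ◃-scal : ∀ l u → (l ◃ scal u) ≈ᵛ (u ·ᵛ l)
  ◃-scal l u j = trans (pair-·ʳ l u (λ i → 1ᴹ i j)) (*-congˡ (◃-identity l j))

  scal-· : ∀ u x i j → (scal u · x) i j ≈ u * x i j
  scal-· u x i j = scal-▹ u (λ k → x k j) i

  ·-scal : ∀ u x i j → (x · scal u) i j ≈ u * x i j
  ·-scal u x i j = ◃-scal (x i) u j

  scal-central : ∀ u x → (scal u · x) ≈ᴹ (x · scal u)
  scal-central u x i j = trans (scal-· u x i j) (sym (·-scal u x i j))

  ▹-0 : ∀ x {w} → w ≈ᵛ 0ᵛ → (x ▹ w) ≈ᵛ 0ᵛ
  ▹-0 x p i = pair-0ʳ (x i) p

  0-◃ : ∀ {l} x → l ≈ᵛ 0ᵛ → (l ◃ x) ≈ᵛ 0ᵛ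
  0-◃ x p j = pair-0ˡ (λ i → x i j) p

  ·ᵛ-◃ : ∀ u m x → ((u ·ᵛ m) ◃ x) ≈ᵛ (u ·ᵛ (m ◃ x))
  ·ᵛ-◃ u m x j = pair-·ˡ u m (λ i → x i j)

  ▹-ext : ∀ {x y} → (∀ v → (x ▹ v) ≈ᵛ (y ▹ v)) → x ≈ᴹ y
  ▹-ext {x} {y} p i j = begin
    x i j         ≈⟨ ·-identityʳ x i j ⟨
    (x · 1ᴹ) i j  ≈⟨ p (λ k → 1ᴹ k j) i ⟩
    (y · 1ᴹ) i j  ≈⟨ ·-identityʳ y i j ⟩
    y i j         ∎

  pair-ext : ∀ {v w} → (∀ l → ⟪ l , v ⟫ ≈ ⟪ l , w ⟫) → v ≈ᵛ w
  pair-ext {v} {w} p i = trans (sym (▹-identity v i)) (trans (p (1ᴹ i)) (▹-identity w i))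

  pair-negʳ : ∀ l v → ⟪ l , (λ i → - v i) ⟫ ≈ - ⟪ l , v ⟫
  pair-negʳ l v = +-inverseˡ-unique _ _
    (trans (sym (pair-+ʳ l _ v)) (pair-0ʳ l (λ i → -‿inverseˡ (v i))))

  pair-negˡ : ∀ l v → ⟪ (λ i → - l i) , v ⟫ ≈ - ⟪ l , v ⟫
  pair-negˡ l v = +-inverseˡ-unique _ _
    (trans (sym (pair-+ˡ _ l v)) (pair-0ˡ v (λ i → -‿inverseˡ (l i))))

  infix 25 -ᴹ_
  -ᴹ_ : Mat → Mat
  (-ᴹ x) i j = - x i j

  infixr 30 _^ᴹ_
  _^ᴹ_ : Mat → ℕ → Mat
  x ^ᴹ zero  = 1ᴹ
  x ^ᴹ suc m = x · (x ^ᴹ m)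

  ^ᴹ-suc : ∀ x m → (x ^ᴹ suc m) ≈ᴹ (x ^ᴹ m · x)
  ^ᴹ-suc x zero    = ≈ᴹ-trans (·-identityʳ x) (≈ᴹ-sym (·-identityˡ x))
  ^ᴹ-suc x (suc m) = ≈ᴹ-trans (·-cong ≈ᴹ-refl (^ᴹ-suc x m)) (≈ᴹ-sym (·-assoc x (x ^ᴹ m) x))

  commutes-neg : ∀ {x} z → (x · z) ≈ᴹ (z · x) → ((-ᴹ x) · z) ≈ᴹ (z · (-ᴹ x))
  commutes-neg {x} z p i j =
    trans (pair-negˡ (x i) (λ k → z k j)) (trans (-‿cong (p i j)) (sym (pair-negʳ (z i) (λ k → x k j))))

-- The power series ring `R[[ε]]` as an R-algebra.

module PowerSeries {c ℓ : Level} (R : CommutativeRing c ℓ) where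
  open CommutativeRing R hiding (zero)
  open Algebra.Properties.Ring ring using (-0#≈0#)
  open Algebra.Properties.CommutativeSemigroup +-commutativeSemigroup using (interchange)
  open Relation.Binary.Reasoning.Setoid setoid

  Series : Set c
  Series = ℕ → Carrier

  tail : Series → Series
  tail f m = f (suc m)

  infix 4 _≋_
  _≋_ : Series → Series → Set ℓ
  f ≋ g = ∀ m → f m ≈ g m

  infixl 7 _⋆_
  -- The Cauchy product, by recursion along `f = f₀ + ε · tail f` instead of a sum over pairs of
  -- indices. With this form a left factor that is linear in ε stops contributing after two terms.
  _⋆_ : Series → Series → Series
  (f ⋆ g) zero    = f zero * g zero
  (f ⋆ g) (suc m) = f zero * g (suc m) + (tail f ⋆ g) m

  const : Carrier → Series
  const u zero    = u
  const u (suc m) = 0#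

  const-cong : ∀ {u w} → u ≈ w → const u ≋ const w
  const-cong p zero    = p
  const-cong p (suc m) = refl

  ⋆-cong : Congruent₂ _≋_ _⋆_
  ⋆-cong p q zero    = *-cong (p 0) (q 0)
  ⋆-cong p q (suc m) = +-cong (*-cong (p 0) (q (suc m))) (⋆-cong (λ k → p (suc k)) q m)

  -- The same product unfolded along the right factor. Having both unfoldings makes commutativity a
  -- plain induction.
  ⋆-suc : ∀ f g m → (f ⋆ g) (suc m) ≈ (f ⋆ tail g) m + f (suc m) * g zero
  ⋆-suc f g zero    = refl
  ⋆-suc f g (suc m) = trans (+-congˡ (⋆-suc (tail f) g m)) (sym (+-assoc _ _ _))

  ⋆-comm : Commutative _≋_ _⋆_
  ⋆-comm f g zero    = *-comm _ _
  ⋆-comm f g (suc m) = begin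
    f zero * g (suc m) + (tail f ⋆ g) m  ≈⟨ +-cong (*-comm _ _) (⋆-comm (tail f) g m) ⟩
    g (suc m) * f zero + (g ⋆ tail f) m  ≈⟨ +-comm _ _ ⟩
    (g ⋆ tail f) m + g (suc m) * f zero  ≈⟨ ⋆-suc g f m ⟨
    (g ⋆ f) (suc m)                      ∎

  ⋆-zeroˡ : ∀ {f} g → (∀ m → f m ≈ 0#) → ∀ m → (f ⋆ g) m ≈ 0#
  ⋆-zeroˡ g p zero    = trans (*-congʳ (p 0)) (zeroˡ _)
  ⋆-zeroˡ g p (suc m) = trans (+-cong (trans (*-congʳ (p 0)) (zeroˡ _)) (⋆-zeroˡ g (λ k → p (suc k)) m)) (+-identityˡ 0#)

  ⋆-scaleˡ : ∀ u f g m → ((λ k → u * f k) ⋆ g) m ≈ u * (f ⋆ g) m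
  ⋆-scaleˡ u f g zero    = *-assoc _ _ _
  ⋆-scaleˡ u f g (suc m) = trans (+-cong (*-assoc _ _ _) (⋆-scaleˡ u (tail f) g m)) (sym (distribˡ _ _ _))

  ⋆-distribʳ : ∀ h f g m → ((λ k → f k + g k) ⋆ h) m ≈ (f ⋆ h) m + (g ⋆ h) m
  ⋆-distribʳ h f g zero    = distribʳ _ _ _
  ⋆-distribʳ h f g (suc m) = trans (+-cong (distribʳ _ _ _) (⋆-distribʳ h (tail f) (tail g) m)) (interchange _ _ _ _)

  ⋆-distribˡ : ∀ h f g m → (h ⋆ (λ k → f k + g k)) m ≈ (h ⋆ f) m + (h ⋆ g) m
  ⋆-distribˡ h f g m = trans (⋆-comm h _ m)
    (trans (⋆-distribʳ h f g m) (+-cong (⋆-comm f h m) (⋆-comm g h m)))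

  ⋆-assoc : Associative _≋_ _⋆_
  ⋆-assoc f g h zero    = *-assoc _ _ _
  ⋆-assoc f g h (suc m) = begin
    f zero * g zero * h (suc m) + ((λ k → f zero * g (suc k) + (tail f ⋆ g) k) ⋆ h) m
      ≈⟨ +-cong (*-assoc _ _ _) (⋆-distribʳ h (λ k → f zero * g (suc k)) (tail f ⋆ g) m) ⟩
    f zero * (g zero * h (suc m)) + (((λ k → f zero * g (suc k)) ⋆ h) m + ((tail f ⋆ g) ⋆ h) m)
      ≈⟨ +-congˡ (+-cong (⋆-scaleˡ (f zero) (tail g) h m) (⋆-assoc (tail f) g h m)) ⟩
    f zero * (g zero * h (suc m)) + (f zero * (tail g ⋆ h) m + (tail f ⋆ (g ⋆ h)) m)
      ≈⟨ +-assoc _ _ _ ⟨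
    f zero * (g zero * h (suc m)) + f zero * (tail g ⋆ h) m + (tail f ⋆ (g ⋆ h)) m
      ≈⟨ +-congʳ (sym (distribˡ _ _ _)) ⟩
    f zero * (g ⋆ h) (suc m) + (tail f ⋆ (g ⋆ h)) m ∎

  Linear : Series → Set ℓ
  Linear f = ∀ m → f (suc (suc m)) ≈ 0#

  ⋆-linearˡ : ∀ f g → Linear f → ∀ m → (f ⋆ g) (suc m) ≈ f 0 * g (suc m) + f 1 * g m
  ⋆-linearˡ f g p zero    = refl
  ⋆-linearˡ f g p (suc m) = +-congˡ (trans (+-congˡ (⋆-zeroˡ g p m)) (+-identityʳ _))

  ⋆-constˡ : ∀ u g m → (const u ⋆ g) m ≈ u * g m
  ⋆-constˡ u g zero    = refl
  ⋆-constˡ u g (suc m) = trans (+-congˡ (⋆-zeroˡ g (λ _ → refl) m)) (+-identityʳ _)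

  ⋆-identityˡ : ∀ f → const 1# ⋆ f ≋ f
  ⋆-identityˡ f m = trans (⋆-constˡ 1# f m) (*-identityˡ _)

  private module +-Series = CommutativeRing (Algebra.Construct.Pointwise.commutativeRing ℕ R)

  seriesRing : CommutativeRing c ℓ
  seriesRing = record
    { Carrier = Series
    ; _≈_ = _≋_
    ; _+_ = λ f g m → f m + g m
    ; _*_ = _⋆_
    ; -_  = λ f m → - f m
    ; 0#  = λ m → 0#
    ; 1#  = const 1#
    ; isCommutativeRing = record
      { isRing = record
        { +-isAbelianGroup = +-Series.+-isAbelianGroup
        ; *-cong     = ⋆-cong
        ; *-assoc    = ⋆-assoc
        ; *-identity = ⋆-identityˡ , λ f m → trans (⋆-comm f _ m) (⋆-identityˡ f m)
        ; distrib    = ⋆-distribˡ , ⋆-distribʳ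
        }
      ; *-comm = ⋆-comm
      }
    }

  -- Series are functions from ℕ, so the universe levels remain those of `R` and this is one of the
  -- algebras over which the hypothesis on X ranges.
  seriesAlgebra : Algebra R c ℓ
  seriesAlgebra = record
    { ring  = seriesRing
    ; φ     = const
    ; isHom = record
      { isSemiringHomomorphism = record
        { isNearSemiringHomomorphism = record
          { +-isMonoidHomomorphism = record
            { isMagmaHomomorphism = record
              { isRelHomomorphism = record { cong = const-cong }
              ; homo = const-+
              }
            ; ε-homo = const-0
            }
          ; *-homo = const-*
          }
        ; 1#-homo = λ m → refl
        }
      ; -‿homo = const-neg
      }
    }
    where
    const-+ : ∀ u w → const (u + w) ≋ λ m → const u m + const w m
    const-+ u w zero    = refl
    const-+ u w (suc m) = sym (+-identityˡ 0#)

    const-0 : const 0# ≋ λ m → 0#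
    const-0 zero    = refl
    const-0 (suc m) = refl

    const-* : ∀ u w → const (u * w) ≋ const u ⋆ const w
    const-* u w zero    = refl
    const-* u w (suc m) = sym (trans (⋆-constˡ u (const w) (suc m)) (zeroʳ u))

    const-neg : ∀ u → const (- u) ≋ λ m → - const u m
    const-neg u zero    = refl
    const-neg u (suc m) = sym -0#≈0#

-- The centralizer of τ and its action on cyclic vectors and covectors.

module Cyclic {c ℓ : Level} (R : CommutativeRing c ℓ) (n : ℕ) (τ : LinAlg.Mat R n) where
  open CommutativeRing R hiding (zero)
  open LinAlg R n
  open MatrixProperties R n
  open Algebra.Properties.CommutativeSemigroup +-commutativeSemigroup using (interchange)
  open Algebra.Properties.CommutativeSemigroup *-commutativeSemigroup using (x∙yz≈y∙xz)

  Commutes : Mat → Set ℓ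
  Commutes x = (x · τ) ≈ᴹ (τ · x)

  commutes-· : ∀ {x y} → Commutes x → Commutes y → Commutes (x · y)
  commutes-· {x} {y} cx cy = ≈ᴹ-trans (·-assoc x y τ) (
    ≈ᴹ-trans (·-cong ≈ᴹ-refl cy) (≈ᴹ-trans (≈ᴹ-sym (·-assoc x τ y)) (
    ≈ᴹ-trans (·-cong cx ≈ᴹ-refl) (·-assoc τ x y))))

  commutes-+ : ∀ {x y} → Commutes x → Commutes y → Commutes (x +ᴹ y)
  commutes-+ {x} {y} cx cy = ≈ᴹ-trans (·-distribʳ τ x y)
    (≈ᴹ-trans (λ i j → +-cong (cx i j) (cy i j)) (≈ᴹ-sym (·-distribˡ τ x y)))

  commutes-0 : Commutes 0ᴹ
  commutes-0 i j = trans (pair-0ˡ (λ k → τ k j) (λ _ → refl)) (sym (pair-0ʳ (τ i) (λ _ → refl)))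

  commutes-inverse : ∀ {x x′} → (x · x′) ≈ᴹ 1ᴹ → (x′ · x) ≈ᴹ 1ᴹ → Commutes x → Commutes x′
  commutes-inverse {x} {x′} xx′≈1 x′x≈1 cx = begin
    x′ · τ               ≈⟨ ·-identityʳ _ ⟨
    (x′ · τ) · 1ᴹ        ≈⟨ ·-cong ≈ᴹ-refl xx′≈1 ⟨
    (x′ · τ) · (x · x′)  ≈⟨ ·-assoc _ _ _ ⟨
    ((x′ · τ) · x) · x′  ≈⟨ ·-cong (·-assoc _ _ _) ≈ᴹ-refl ⟩
    (x′ · (τ · x)) · x′  ≈⟨ ·-cong (·-cong ≈ᴹ-refl cx) ≈ᴹ-refl ⟨
    (x′ · (x · τ)) · x′  ≈⟨ ·-cong (·-assoc _ _ _) ≈ᴹ-refl ⟨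
    ((x′ · x) · τ) · x′  ≈⟨ ·-cong (·-cong x′x≈1 ≈ᴹ-refl) ≈ᴹ-refl ⟩
    (1ᴹ · τ) · x′        ≈⟨ ·-cong (·-identityˡ τ) ≈ᴹ-refl ⟩
    τ · x′               ∎
    where open Mat-Reasoning

  open Relation.Binary.Reasoning.Setoid setoid

  -- R[τ]-linearity, stated for functions so that both a matrix commuting with τ and the operator
  -- `polyAct p τ`, which is not given as a matrix, are instances.
  record Equivariant (F : Vect → Vect) : Set (c ⊔ ℓ) where
    field
      cong   : ∀ {v w} → v ≈ᵛ w → F v ≈ᵛ F w
      homo-+ : ∀ v w → F (v +ᵛ w) ≈ᵛ (F v +ᵛ F w)
      homo-· : ∀ u v → F (u ·ᵛ v) ≈ᵛ (u ·ᵛ F v)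
      homo-τ : ∀ v → F (τ ▹ v) ≈ᵛ (τ ▹ F v)

    homo-0 : F 0ᵛ ≈ᵛ 0ᵛ
    homo-0 i = begin
      F 0ᵛ i          ≈⟨ cong (λ j → sym (zeroˡ 0#)) i ⟩
      F (0# ·ᵛ 0ᵛ) i  ≈⟨ homo-· 0# 0ᵛ i ⟩
      0# * F 0ᵛ i     ≈⟨ zeroˡ _ ⟩
      0#              ∎

  polyAct-cong : ∀ p {v w} → v ≈ᵛ w → polyAct p τ v ≈ᵛ polyAct p τ w
  polyAct-cong []       q i = refl
  polyAct-cong (a ∷ as) q i = +-cong (*-congˡ (q i)) (polyAct-cong as (▹-cong ≈ᴹ-refl q) i)

  commutes⇒equivariant : ∀ {x} → Commutes x → Equivariant (x ▹_)
  commutes⇒equivariant {x} xτ≈τx = record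
    { cong   = ▹-cong ≈ᴹ-refl
    ; homo-+ = ▹-+ x
    ; homo-· = ▹-·ᵛ x
    ; homo-τ = λ v → ≈ᵛ-trans (≈ᵛ-sym (▹-assoc x τ v)) (≈ᵛ-trans (▹-cong xτ≈τx ≈ᵛ-refl) (▹-assoc τ x v))
    }

  equivariant-polyAct : ∀ {F} → Equivariant F → ∀ p v → F (polyAct p τ v) ≈ᵛ polyAct p τ (F v)
  equivariant-polyAct E []       v = Equivariant.homo-0 E
  equivariant-polyAct {F} E (a ∷ as) v i = begin
    F ((a ·ᵛ v) +ᵛ polyAct as τ (τ ▹ v)) i     ≈⟨ homo-+ _ _ i ⟩
    F (a ·ᵛ v) i + F (polyAct as τ (τ ▹ v)) i  ≈⟨ +-cong (homo-· a v i) (equivariant-polyAct E as (τ ▹ v) i) ⟩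
    a * F v i + polyAct as τ (F (τ ▹ v)) i     ≈⟨ +-congˡ (polyAct-cong as (homo-τ v) i) ⟩
    a * F v i + polyAct as τ (τ ▹ F v) i       ∎
    where open Equivariant E

  polyAct-+ : ∀ p v w → polyAct p τ (v +ᵛ w) ≈ᵛ (polyAct p τ v +ᵛ polyAct p τ w)
  polyAct-+ []       v w i = sym (+-identityˡ 0#)
  polyAct-+ (a ∷ as) v w i = begin
    a * (v i + w i) + polyAct as τ (τ ▹ (v +ᵛ w)) i
      ≈⟨ +-cong (distribˡ _ _ _) (≈ᵛ-trans (polyAct-cong as (▹-+ τ v w)) (polyAct-+ as _ _) i) ⟩
    a * v i + a * w i + (polyAct as τ (τ ▹ v) i + polyAct as τ (τ ▹ w) i)
      ≈⟨ interchange _ _ _ _ ⟩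
    a * v i + polyAct as τ (τ ▹ v) i + (a * w i + polyAct as τ (τ ▹ w) i) ∎

  polyAct-· : ∀ p u v → polyAct p τ (u ·ᵛ v) ≈ᵛ (u ·ᵛ polyAct p τ v)
  polyAct-· []       u v i = sym (zeroʳ u)
  polyAct-· (a ∷ as) u v i = begin
    a * (u * v i) + polyAct as τ (τ ▹ (u ·ᵛ v)) i
      ≈⟨ +-cong (x∙yz≈y∙xz _ _ _) (≈ᵛ-trans (polyAct-cong as (▹-·ᵛ τ u v)) (polyAct-· as u _) i) ⟩
    u * (a * v i) + u * polyAct as τ (τ ▹ v) i
      ≈⟨ distribˡ _ _ _ ⟨
    u * (a * v i + polyAct as τ (τ ▹ v) i) ∎

  polyAct-equivariant : ∀ p → Equivariant (polyAct p τ)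
  polyAct-equivariant p = record
    { cong   = polyAct-cong p
    ; homo-+ = polyAct-+ p
    ; homo-· = polyAct-· p
    -- `Commutes τ` unfolds to reflexivity at `τ · τ`; this term serves as its proof throughout.
    ; homo-τ = λ v → ≈ᵛ-sym (equivariant-polyAct (commutes⇒equivariant (≈ᴹ-refl {τ · τ})) p v)
    }

  -- The left and right actions of p(τ) are adjoint. Transposing moves one τ outside the polynomial,
  -- and it returns inside because τ commutes with p(τ).
  pair-polyActL : ∀ p l v → ⟪ polyActL p l τ , v ⟫ ≈ ⟪ l , polyAct p τ v ⟫
  pair-polyActL []       l v = trans (pair-0ˡ v (λ _ → refl)) (sym (pair-0ʳ l (λ _ → refl)))
  pair-polyActL (a ∷ as) l v = begin
    ⟪ (a ·ᵛ l) +ᵛ polyActL as (l ◃ τ) τ , v ⟫       ≈⟨ pair-+ˡ _ _ v ⟩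
    ⟪ a ·ᵛ l , v ⟫ + ⟪ polyActL as (l ◃ τ) τ , v ⟫  ≈⟨ +-cong (pair-·ˡ a l v) (pair-polyActL as (l ◃ τ) v) ⟩
    a * ⟪ l , v ⟫ + ⟪ l ◃ τ , polyAct as τ v ⟫      ≈⟨ +-cong (sym (pair-·ʳ l a v)) (Σ-assoc l τ _) ⟩
    ⟪ l , a ·ᵛ v ⟫ + ⟪ l , τ ▹ polyAct as τ v ⟫     ≈⟨ +-congˡ (pair-cong (λ _ → refl) (equivariant-polyAct (commutes⇒equivariant (≈ᴹ-refl {τ · τ})) as v)) ⟩
    ⟪ l , a ·ᵛ v ⟫ + ⟪ l , polyAct as τ (τ ▹ v) ⟫   ≈⟨ pair-+ʳ l _ _ ⟨
    ⟪ l , polyAct (a ∷ as) τ v ⟫                    ∎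

  module _ {v : Vect} (cyclic : CyclicVec τ v) where
    -- An R[τ]-linear map is determined by its value at a generator. This is how equations in the
    -- centralizer are proved below: they are checked at `eR` only.
    cyclic-ext : ∀ {x y} → Commutes x → Commutes y → (x ▹ v) ≈ᵛ (y ▹ v) → x ≈ᴹ y
    cyclic-ext {x} {y} cx cy xv≈yv = ▹-ext λ w →
      let p , pv≈w = cyclic w in
      ≈ᵛ-trans (▹-cong ≈ᴹ-refl (≈ᵛ-sym pv≈w)) (
      ≈ᵛ-trans (equivariant-polyAct (commutes⇒equivariant cx) p v) (
      ≈ᵛ-trans (polyAct-cong p xv≈yv) (
      ≈ᵛ-trans (≈ᵛ-sym (equivariant-polyAct (commutes⇒equivariant cy) p v))
               (▹-cong ≈ᴹ-refl pv≈w))))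

    private
      -- At a generator, x and y act as polynomials p and q in τ. The product acts as q(τ)p(τ),
      -- which is symmetric in x and y since polynomials in τ commute.
      comm-at-cyclic : ∀ {x y} → Commutes x → Commutes y →
        ∀ p q → polyAct p τ v ≈ᵛ (x ▹ v) → polyAct q τ v ≈ᵛ (y ▹ v) →
        ((x · y) ▹ v) ≈ᵛ polyAct q τ (polyAct p τ v)
      comm-at-cyclic {x} {y} cx cy p q pv≈xv qv≈yv =
        ≈ᵛ-trans (▹-assoc x y v) (
        ≈ᵛ-trans (▹-cong ≈ᴹ-refl (≈ᵛ-sym qv≈yv)) (
        ≈ᵛ-trans (equivariant-polyAct (commutes⇒equivariant cx) q v)
                 (polyAct-cong q (≈ᵛ-sym pv≈xv))))

    centralizer-comm : ∀ {x y} → Commutes x → Commutes y → (x · y) ≈ᴹ (y · x)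
    centralizer-comm {x} {y} cx cy =
      let p , pv≈xv = cyclic (x ▹ v)
          q , qv≈yv = cyclic (y ▹ v)
      in cyclic-ext (commutes-· cx cy) (commutes-· cy cx) (
        ≈ᵛ-trans (comm-at-cyclic cx cy p q pv≈xv qv≈yv) (
        ≈ᵛ-trans (equivariant-polyAct (polyAct-equivariant q) p v)
                 (≈ᵛ-sym (comm-at-cyclic cy cx q p qv≈yv pv≈xv))))

  -- Every covector m is `l p(τ)`, and p(τ) can be moved past a z in the centralizer:
  -- `m z w = l z p(τ) w`. Hence `l z` already determines z.
  cyclic-coext : ∀ {l} → CyclicCovec τ l → ∀ {x y} → Commutes x → Commutes y →
    (l ◃ x) ≈ᵛ (l ◃ y) → x ≈ᴹ y
  cyclic-coext {l} cyclic {x} {y} cx cy lx≈ly = ▹-ext λ w → pair-ext λ m →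
    let p , lp≈m = cyclic m
        pair : ∀ {z} → Commutes z → ⟪ m , z ▹ w ⟫ ≈ ⟪ l ◃ z , polyAct p τ w ⟫
        pair {z} cz = begin
          ⟪ m , z ▹ w ⟫                ≈⟨ pair-cong lp≈m (λ _ → refl) ⟨
          ⟪ polyActL p l τ , z ▹ w ⟫   ≈⟨ pair-polyActL p l (z ▹ w) ⟩
          ⟪ l , polyAct p τ (z ▹ w) ⟫  ≈⟨ pair-cong (λ _ → refl) (equivariant-polyAct (commutes⇒equivariant cz) p w) ⟨
          ⟪ l , z ▹ polyAct p τ w ⟫    ≈⟨ Σ-assoc l z _ ⟨
          ⟪ l ◃ z , polyAct p τ w ⟫    ∎
    in trans (pair cx) (trans (pair-cong lx≈ly (λ _ → refl)) (sym (pair cy)))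

-- Compatibility of the matrix operations, of `e`, `e*` and of `τ ᴴ` with base change.

module BaseChange {c ℓ c′ ℓ′ : Level} {R : CommutativeRing c ℓ} (A : Algebra R c′ ℓ′) (n : ℕ) where
  open Algebra A renaming (ring to S)
  open CommutativeRing S hiding (zero)
  open RingMorphisms.IsRingHomomorphism isHom
  open MatrixProperties S n using (Σ-cong; ≈ᴹ-sym; ≈ᴹ-trans; ·-cong)
  private
    module R = LinAlg R n
    module S = LinAlg S n

  φ-Σ : ∀ {m} (f : Fin m → CommutativeRing.Carrier R) → φ R.Σ[ f ] ≈ S.Σ[ (λ i → φ (f i)) ]
  φ-Σ {zero}  f = 0#-homo
  φ-Σ {suc m} f = trans (+-homo _ _) (+-congˡ (φ-Σ (λ i → f (suc i))))

  φ-pair : ∀ l v → φ R.⟪ l , v ⟫ ≈ S.⟪ (λ i → φ (l i)) , (λ i → φ (v i)) ⟫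
  φ-pair l v = trans (φ-Σ {n} _) (Σ-cong {n} (λ i → *-homo _ _))

  φ-· : ∀ x y → baseMat A (x R.· y) S.≈ᴹ (baseMat A x S.· baseMat A y)
  φ-· x y i j = φ-pair (x i) (λ k → y k j)

  φ-1ᴹ : baseMat A R.1ᴹ S.≈ᴹ S.1ᴹ
  φ-1ᴹ i j with does (i Fin.≟ j)
  ... | true  = 1#-homo
  ... | false = 0#-homo

  φ-fromℕ : ∀ k → φ (R.fromℕ k) ≈ S.fromℕ k
  φ-fromℕ zero    = 0#-homo
  φ-fromℕ (suc k) = trans (+-homo _ _) (+-cong 1#-homo (φ-fromℕ k))

  φ-fromℤ : ∀ k → φ (R.fromℤ k) ≈ S.fromℤ k
  φ-fromℤ (+ k)    = φ-fromℕ k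
  φ-fromℤ -[1+ k ] = trans (-‿homo _) (-‿cong (φ-fromℕ (suc k)))

  φ-1H : ∀ e e* → baseMat A (R.WithE.1H e e*) S.≈ᴹ S.WithE.1H e e*
  φ-1H e e* i j = trans (+-homo _ _) (+-cong (φ-1ᴹ i j) (trans (-‿homo _)
    (-‿cong (trans (*-homo _ _) (*-cong (φ-fromℤ (e i)) (φ-fromℤ (e* j)))))))

  φ-ᴴ : ∀ e e* τ → baseMat A (R.WithE._ᴴ e e* τ) S.≈ᴹ S.WithE._ᴴ e e* (baseMat A τ)
  φ-ᴴ e e* τ = ≈ᴹ-trans (φ-· _ _) (·-cong (≈ᴹ-trans (φ-· _ _) (·-cong (φ-1H e e*) (λ _ _ → refl))) (φ-1H e e*))

-- The ring map from ℤ to R and the pairing of integral vectors.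

module IntegerHomomorphism {c ℓ : Level} (R : CommutativeRing c ℓ) (n : ℕ) where
  open CommutativeRing R hiding (zero)
  open LinAlg R n
  open Algebra.Properties.Ring ring using (-0#≈0#; -‿+-comm; -‿involutive; -‿distribˡ-*)
  open Algebra.Properties.CommutativeSemigroup +-commutativeSemigroup using (interchange)
  open Relation.Binary.Reasoning.Setoid setoid

  fromℕ-+ : ∀ j k → fromℕ (j ℕ.+ k) ≈ fromℕ j + fromℕ k
  fromℕ-+ zero    k = sym (+-identityˡ _)
  fromℕ-+ (suc j) k = trans (+-congˡ (fromℕ-+ j k)) (sym (+-assoc _ _ _))

  fromℤ-⊖ : ∀ j k → fromℤ (j ⊖ k) ≈ fromℕ j - fromℕ k
  fromℤ-⊖ zero    zero    = sym (trans (+-congˡ -0#≈0#) (+-identityʳ 0#))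
  fromℤ-⊖ zero    (suc k) = sym (+-identityˡ _)
  fromℤ-⊖ (suc j) zero    = sym (trans (+-congˡ -0#≈0#) (+-identityʳ _))
  fromℤ-⊖ (suc j) (suc k) = begin
    fromℤ (suc j ⊖ suc k)                    ≡⟨ ≡.cong fromℤ (ℤ.[1+m]⊖[1+n]≡m⊖n j k) ⟩
    fromℤ (j ⊖ k)                            ≈⟨ fromℤ-⊖ j k ⟩
    fromℕ j - fromℕ k                        ≈⟨ +-identityˡ _ ⟨
    0# + (fromℕ j - fromℕ k)                 ≈⟨ +-congʳ (-‿inverseʳ 1#) ⟨
    1# + - 1# + (fromℕ j - fromℕ k)          ≈⟨ interchange _ _ _ _ ⟩
    1# + fromℕ j + (- 1# + - fromℕ k)        ≈⟨ +-congˡ (-‿+-comm _ _) ⟩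
    1# + fromℕ j - (1# + fromℕ k)            ∎

  fromℤ-+ : ∀ i j → fromℤ (i ℤ.+ j) ≈ fromℤ i + fromℤ j
  fromℤ-+ (ℤ.+ j)   (ℤ.+ k)   = fromℕ-+ j k
  fromℤ-+ (ℤ.+ j)   -[1+ k ]  = fromℤ-⊖ j (suc k)
  fromℤ-+ -[1+ j ]  (ℤ.+ k)   = trans (fromℤ-⊖ k (suc j)) (+-comm _ _)
  fromℤ-+ -[1+ j ]  -[1+ k ]  = begin
    - fromℕ (suc (suc (j ℕ.+ k)))            ≡⟨ ≡.cong (λ m → - fromℕ (suc m)) (ℕ.+-suc j k) ⟨
    - fromℕ (suc j ℕ.+ suc k)                ≈⟨ -‿cong (fromℕ-+ (suc j) (suc k)) ⟩
    - (fromℕ (suc j) + fromℕ (suc k))        ≈⟨ -‿+-comm _ _ ⟨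
    - fromℕ (suc j) + - fromℕ (suc k)        ∎

  fromℤ-neg : ∀ i → fromℤ (ℤ.- i) ≈ - fromℤ i
  fromℤ-neg (ℤ.+ zero)  = sym -0#≈0#
  fromℤ-neg (ℤ.+ suc k) = refl
  fromℤ-neg -[1+ k ]    = sym (-‿involutive _)

  fromℤ-*-pos : ∀ k j → fromℤ (ℤ.+ k ℤ.* j) ≈ fromℕ k * fromℤ j
  fromℤ-*-pos zero    j = trans (reflexive (≡.cong fromℤ (ℤ.*-zeroˡ j))) (sym (zeroˡ _))
  fromℤ-*-pos (suc k) j = begin
    fromℤ (ℤ.+ suc k ℤ.* j)         ≡⟨ ≡.cong fromℤ (ℤ.suc-* (ℤ.+ k) j) ⟩
    fromℤ (j ℤ.+ ℤ.+ k ℤ.* j)       ≈⟨ fromℤ-+ j (ℤ.+ k ℤ.* j) ⟩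
    fromℤ j + fromℤ (ℤ.+ k ℤ.* j)   ≈⟨ +-cong (sym (*-identityˡ _)) (fromℤ-*-pos k j) ⟩
    1# * fromℤ j + fromℕ k * fromℤ j ≈⟨ distribʳ _ _ _ ⟨
    fromℕ (suc k) * fromℤ j         ∎

  fromℤ-* : ∀ i j → fromℤ (i ℤ.* j) ≈ fromℤ i * fromℤ j
  fromℤ-* (ℤ.+ k)  j = fromℤ-*-pos k j
  fromℤ-* -[1+ k ] j = begin
    fromℤ (-[1+ k ] ℤ.* j)            ≡⟨ ≡.cong fromℤ (ℤ.neg-distribˡ-* (ℤ.+ suc k) j) ⟨
    fromℤ (ℤ.- (ℤ.+ suc k ℤ.* j))     ≈⟨ fromℤ-neg (ℤ.+ suc k ℤ.* j) ⟩
    - fromℤ (ℤ.+ suc k ℤ.* j)         ≈⟨ -‿cong (fromℤ-*-pos (suc k) j) ⟩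
    - (fromℕ (suc k) * fromℤ j)       ≈⟨ -‿distribˡ-* _ _ ⟩
    - fromℕ (suc k) * fromℤ j         ∎

  fromℤ-Σ : ∀ {m} (f : Fin m → ℤ) → fromℤ (ℤsum f) ≈ Σ[ (λ i → fromℤ (f i)) ]
  fromℤ-Σ {zero}  f = refl
  fromℤ-Σ {suc m} f = trans (fromℤ-+ (f zero) _) (+-congˡ (fromℤ-Σ (λ i → f (suc i))))

  fromℤ-pair : ∀ (l v : Fin n → ℤ) → fromℤ (ℤpair l v) ≈ ⟪ (λ i → fromℤ (l i)) , (λ i → fromℤ (v i)) ⟫
  fromℤ-pair l v = trans (fromℤ-Σ {n} _) (MatrixProperties.Σ-cong R n {n} (λ i → fromℤ-* (l i) (v i)))

-- The centralizer of τ as a commutative semiring containing the scalars.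

module Centralizer {c ℓ : Level} (R : CommutativeRing c ℓ) (n : ℕ) (τ : LinAlg.Mat R n)
  (v : LinAlg.Vect R n) (cyclic : LinAlg.CyclicVec R n τ v) where
  open CommutativeRing R hiding (zero)
  open LinAlg R n
  open MatrixProperties R n
  open Cyclic R n τ
  open Algebra.Properties.Ring ring using (+-cancelˡ)

  -- Multiplication is commutative because `v` is cyclic. Relations in the centralizer are written
  -- without subtraction, so that the semiring solver applies; additive cancellation takes the place
  -- of negatives.
  centralizer : CommutativeSemiring (c ⊔ ℓ) ℓ
  centralizer = record
    { Carrier = ∃ Commutes
    ; _≈_ = λ x y → proj₁ x ≈ᴹ proj₁ y
    ; _+_ = λ (x , cx) (y , cy) → x +ᴹ y , commutes-+ cx cy
    ; _*_ = λ (x , cx) (y , cy) → x · y , commutes-· cx cy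
    ; 0#  = 0ᴹ , commutes-0
    ; 1#  = 1ᴹ , ≈ᴹ-trans (·-identityˡ τ) (≈ᴹ-sym (·-identityʳ τ))
    ; isCommutativeSemiring = IsCommutativeSemiringˡ.isCommutativeSemiring record
      { +-isCommutativeMonoid = IsCommutativeMonoidˡ.isCommutativeMonoid record
        { isSemigroup = record
          { isMagma = record
            { isEquivalence = isEquiv
            ; ∙-cong = λ p q i j → +-cong (p i j) (q i j)
            }
          ; assoc = λ x y z i j → +-assoc _ _ _
          }
        ; identityˡ = λ x i j → +-identityˡ _
        ; comm = λ x y i j → +-comm _ _
        }
      ; *-isCommutativeMonoid = IsCommutativeMonoidˡ.isCommutativeMonoid record
        { isSemigroup = record
          { isMagma = record { isEquivalence = isEquiv ; ∙-cong = ·-cong }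
          ; assoc = λ x y z → ·-assoc (proj₁ x) (proj₁ y) (proj₁ z)
          }
        ; identityˡ = λ x → ·-identityˡ (proj₁ x)
        ; comm = λ x y → centralizer-comm cyclic (proj₂ x) (proj₂ y)
        }
      ; distribʳ = λ x y z → ·-distribʳ (proj₁ x) (proj₁ y) (proj₁ z)
      ; zeroˡ = λ x i j → pair-0ˡ (λ k → proj₁ x k j) (λ _ → refl)
      }
    }
    where
    isEquiv : IsEquivalence {A = ∃ Commutes} (λ x y → proj₁ x ≈ᴹ proj₁ y)
    isEquiv = record { refl = ≈ᴹ-refl ; sym = ≈ᴹ-sym ; trans = ≈ᴹ-trans }

  centralizer-cancelˡ : LeftCancellative (CommutativeSemiring._≈_ centralizer) (CommutativeSemiring._+_ centralizer)
  centralizer-cancelˡ x y z p i j = +-cancelˡ _ _ _ (p i j)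

  scalar : Carrier → ∃ Commutes
  scalar u = scal u , scal-central u τ

  scalar-* : ∀ u w → scal (u * w) ≈ᴹ (scal u · scal w)
  scalar-* u w i j = trans (*-assoc _ _ _) (sym (scal-· u (scal w) i j))

  scalar-+ : ∀ u w → scal (u + w) ≈ᴹ (scal u +ᴹ scal w)
  scalar-+ u w i j = distribʳ _ _ _

  scalar-cong : ∀ {u w} → u ≈ w → scal u ≈ᴹ scal w
  scalar-cong p i j = *-congʳ p

  scalar-1 : scal 1# ≈ᴹ 1ᴹ
  scalar-1 i j = *-identityˡ _

-- What membership in `H · G_τ` says about the factor in `G_τ`.

module Factorization {c ℓ : Level} (R : CommutativeRing c ℓ) (n : ℕ) (e e* : Fin n → ℤ) where
  open CommutativeRing R using (Carrier)
  open LinAlg R n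
  open WithE e e*
  open MatrixProperties R n

  -- Since `h` fixes both `e` and `e*`, it vanishes from `e*(hk)` and from `(hk)⁻¹e`, which leaves
  -- two conditions on `k` alone.
  factorization : ∀ τ a a′ y y′ →
    (a′ · a) ≈ᴹ 1ᴹ → (y′ · y) ≈ᴹ 1ᴹ → InHGτ τ (a · y) →
    ∃ λ k → ∃ λ k′ →
      ((k · τ) ≈ᴹ (τ · k)) × ((k · k′) ≈ᴹ 1ᴹ) × ((k′ · k) ≈ᴹ 1ᴹ) ×
      ((e*R ◃ k) ≈ᵛ ((e*R ◃ a) ◃ y)) × ((k′ ▹ eR) ≈ᵛ (y′ ▹ (a′ ▹ eR)))
  factorization τ a a′ y y′ a′a≈1 y′y≈1
    (h , k , (_ , he≈e , e*h≈e*) , ((k′ , kk′≈1 , k′k≈1) , kτ≈τk) , ay≈hk) =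
    k , k′ , kτ≈τk , kk′≈1 , k′k≈1 , e*k , k′e
    where
    e*k : (e*R ◃ k) ≈ᵛ ((e*R ◃ a) ◃ y)
    e*k = begin
      e*R ◃ k          ≈⟨ ◃-cong (≈ᵛ-sym e*h≈e*) ≈ᴹ-refl ⟩
      (e*R ◃ h) ◃ k    ≈⟨ ◃-assoc e*R h k ⟩
      e*R ◃ (h · k)    ≈⟨ ◃-cong ≈ᵛ-refl (≈ᴹ-sym ay≈hk) ⟩
      e*R ◃ (a · y)    ≈⟨ ◃-assoc e*R a y ⟨
      (e*R ◃ a) ◃ y    ∎
      where open Vect-Reasoning

    cancelˡ : ∀ {x x′} v → (x′ · x) ≈ᴹ 1ᴹ → (x′ ▹ (x ▹ v)) ≈ᵛ v
    cancelˡ {x} {x′} v x′x≈1 = ≈ᵛ-trans (≈ᵛ-sym (▹-assoc x′ x v)) (≈ᵛ-trans (▹-cong x′x≈1 ≈ᵛ-refl) (▹-identity v))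

    -- No inverse of `h` is formed: `y′a′ay`, which is the identity, is inserted in front of `k′e`,
    -- and replacing `ay` by `hk` lets `k` meet `k′`.
    k′e : (k′ ▹ eR) ≈ᵛ (y′ ▹ (a′ ▹ eR))
    k′e = begin
      k′ ▹ eR                           ≈⟨ cancelˡ (k′ ▹ eR) y′y≈1 ⟨
      y′ ▹ (y ▹ (k′ ▹ eR))              ≈⟨ ▹-cong ≈ᴹ-refl (cancelˡ (y ▹ (k′ ▹ eR)) a′a≈1) ⟨
      y′ ▹ (a′ ▹ (a ▹ (y ▹ (k′ ▹ eR)))) ≈⟨ ▹-cong ≈ᴹ-refl (▹-cong ≈ᴹ-refl (▹-assoc a y _)) ⟨
      y′ ▹ (a′ ▹ ((a · y) ▹ (k′ ▹ eR))) ≈⟨ ▹-cong ≈ᴹ-refl (▹-cong ≈ᴹ-refl (▹-cong ay≈hk ≈ᵛ-refl)) ⟩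
      y′ ▹ (a′ ▹ ((h · k) ▹ (k′ ▹ eR))) ≈⟨ ▹-cong ≈ᴹ-refl (▹-cong ≈ᴹ-refl (▹-assoc h k _)) ⟩
      y′ ▹ (a′ ▹ (h ▹ (k ▹ (k′ ▹ eR)))) ≈⟨ ▹-cong ≈ᴹ-refl (▹-cong ≈ᴹ-refl (▹-cong ≈ᴹ-refl (cancelˡ eR kk′≈1))) ⟩
      y′ ▹ (a′ ▹ (h ▹ eR))              ≈⟨ ▹-cong ≈ᴹ-refl (▹-cong ≈ᴹ-refl he≈e) ⟩
      y′ ▹ (a′ ▹ eR)                    ∎
      where open Vect-Reasoning

-- Coefficients of matrices over `R[[ε]]`, and the deformations they yield.

module SeriesMatrices {c ℓ : Level} (R : CommutativeRing c ℓ) (n : ℕ) where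
  open CommutativeRing R hiding (zero)
  open PowerSeries R
  open LinAlg R n
  open MatrixProperties R n
  private module S = LinAlg seriesRing n
  open Relation.Binary.Reasoning.Setoid setoid

  coef : (Fin n → Series) → ℕ → Vect
  coef v m i = v i m

  coefᴹ : S.Mat → ℕ → Mat
  coefᴹ x m i j = x i j m

  constᵛ : Vect → Fin n → Series
  constᵛ v i = const (v i)

  Σ-coef : ∀ {k} (f : Fin k → Series) m → S.Σ[ f ] m ≡ Σ[ (λ i → f i m) ]
  Σ-coef {zero}  f m = ≡.refl
  Σ-coef {suc k} f m = ≡.cong (λ u → f zero m + u) (Σ-coef (λ i → f (suc i)) m)

  pair-coef-zero : ∀ l v → S.⟪ l , v ⟫ 0 ≈ ⟪ coef l 0 , coef v 0 ⟫
  pair-coef-zero l v = reflexive (Σ-coef {n} _ 0)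

  -- A factor linear in ε leaves two terms of the Cauchy product. This is applied to `y`, and to `k`
  -- once it is known to be linear.
  pair-coef-linearˡ : ∀ {l} v → (∀ i → Linear (l i)) → ∀ m →
    S.⟪ l , v ⟫ (suc m) ≈ ⟪ coef l 0 , coef v (suc m) ⟫ + ⟪ coef l 1 , coef v m ⟫
  pair-coef-linearˡ {l} v lin m = begin
    S.⟪ l , v ⟫ (suc m)
      ≡⟨ Σ-coef {n} _ (suc m) ⟩
    Σ[ (λ i → (l i ⋆ v i) (suc m)) ]
      ≈⟨ Σ-cong {n} (λ i → ⋆-linearˡ (l i) (v i) (lin i) m) ⟩
    Σ[ (λ i → l i 0 * v i (suc m) + l i 1 * v i m) ]
      ≈⟨ Σ-+ {n} _ _ ⟩
    ⟪ coef l 0 , coef v (suc m) ⟫ + ⟪ coef l 1 , coef v m ⟫ ∎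

  pair-coef-linearʳ : ∀ l {v} → (∀ i → Linear (v i)) → ∀ m →
    S.⟪ l , v ⟫ (suc m) ≈ ⟪ coef l (suc m) , coef v 0 ⟫ + ⟪ coef l m , coef v 1 ⟫
  pair-coef-linearʳ l {v} lin m = begin
    S.⟪ l , v ⟫ (suc m)
      ≡⟨ Σ-coef {n} _ (suc m) ⟩
    Σ[ (λ i → (l i ⋆ v i) (suc m)) ]
      ≈⟨ Σ-cong {n} (λ i → trans (⋆-comm (l i) (v i) (suc m)) (trans (⋆-linearˡ (v i) (l i) (lin i) m) (+-cong (*-comm _ _) (*-comm _ _)))) ⟩
    Σ[ (λ i → l i (suc m) * v i 0 + l i m * v i 1) ]
      ≈⟨ Σ-+ {n} _ _ ⟩
    ⟪ coef l (suc m) , coef v 0 ⟫ + ⟪ coef l m , coef v 1 ⟫ ∎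

  pair-coef-constˡ : ∀ l v m → S.⟪ constᵛ l , v ⟫ m ≈ ⟪ l , coef v m ⟫
  pair-coef-constˡ l v m = trans (reflexive (Σ-coef {n} _ m)) (Σ-cong {n} (λ i → ⋆-constˡ (l i) (v i) m))

  pair-coef-constʳ : ∀ l v m → S.⟪ l , constᵛ v ⟫ m ≈ ⟪ coef l m , v ⟫
  pair-coef-constʳ l v m = trans (reflexive (Σ-coef {n} _ m))
    (Σ-cong {n} (λ i → trans (⋆-comm (l i) _ m) (trans (⋆-constˡ (v i) (l i) m) (*-comm _ _))))

-- The points y = 1 − εη of H_σ(R[[ε]]), whose inverse is Σ εᵐηᵐ, give
-- k = k₀ + εk₁ in G_τ(R[[ε]]); comparing the coefficients of k⁻¹e with those of y⁻¹v,
-- where v = a⁻¹e, yields s = −k₀⁻¹k₁.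
module Deformation {c ℓ : Level} (R : CommutativeRing c ℓ) (n : ℕ) (e e* : Fin n → ℤ)
  (τ a a′ : LinAlg.Mat R n)
  (stable : LinAlg.WithE.Stable R n e e* τ)
  (aa′≈1 : LinAlg._≈ᴹ_ R n (LinAlg._·_ R n a a′) (LinAlg.1ᴹ R n))
  (a′a≈1 : LinAlg._≈ᴹ_ R n (LinAlg._·_ R n a′ a) (LinAlg.1ᴹ R n))
  (H⊆X : (A : Algebra R c ℓ) (y : LinAlg.Mat (Algebra.ring A) n) →
    LinAlg.WithE.InHcent (Algebra.ring A) n e e* (LinAlg.WithE._ᴴ (Algebra.ring A) n e e* (baseMat A τ)) y →
    LinAlg.WithE.InX (Algebra.ring A) n e e* (baseMat A τ) (baseMat A a) y) where
  open CommutativeRing R hiding (zero)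
  open LinAlg R n
  open WithE e e*
  open Algebra.Properties.Ring ring using (-0#≈0#; -‿involutive; +-inverseˡ-unique)
  open PowerSeries R
  open MatrixProperties R n
  open SeriesMatrices R n
  open Cyclic R n τ
  private
    module S = LinAlg seriesRing n
    module SE = S.WithE e e*
    module SR = CommutativeRing seriesRing
    module SM = MatrixProperties seriesRing n
    module BC = BaseChange seriesAlgebra n

  v : Vect
  v = a′ ▹ eR

  l : Covect
  l = e*R ◃ a

  module _ (η : Mat) (ησ≈ση : (η · (τ ᴴ)) ≈ᴹ ((τ ᴴ) · η))
    (ηe≈0 : (η ▹ eR) ≈ᵛ 0ᵛ) (e*η≈0 : (e*R ◃ η) ≈ᵛ 0ᵛ) where

    private
      y y′ : S.Mat
      y i j zero          = 1ᴹ i j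
      y i j (suc zero)    = - η i j
      y i j (suc (suc m)) = 0#
      y′ i j m = (η ^ᴹ m) i j

      1ᴹ-coef : ∀ i j m → S.1ᴹ i j m ≈ const (1ᴹ i j) m
      1ᴹ-coef i j m = sym (BC.φ-1ᴹ i j m)

      yy′≈1 : (y S.· y′) S.≈ᴹ S.1ᴹ
      yy′≈1 i j zero = begin
        (y S.· y′) i j 0  ≈⟨ pair-coef-zero (y i) (λ k → y′ k j) ⟩
        (1ᴹ · 1ᴹ) i j     ≈⟨ ·-identityˡ 1ᴹ i j ⟩
        1ᴹ i j            ≈⟨ 1ᴹ-coef i j 0 ⟨
        S.1ᴹ i j 0        ∎
        where open Relation.Binary.Reasoning.Setoid setoid
      yy′≈1 i j (suc m) = begin
        (y S.· y′) i j (suc m)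
          ≈⟨ pair-coef-linearˡ {y i} (λ k → y′ k j) (λ k m → refl) m ⟩
        (1ᴹ · (η ^ᴹ suc m)) i j + ((-ᴹ η) · (η ^ᴹ m)) i j
          ≈⟨ +-cong (·-identityˡ (η ^ᴹ suc m) i j) (pair-negˡ (η i) (λ k → (η ^ᴹ m) k j)) ⟩
        (η ^ᴹ suc m) i j + - (η ^ᴹ suc m) i j
          ≈⟨ -‿inverseʳ _ ⟩
        0#
          ≈⟨ 1ᴹ-coef i j (suc m) ⟨
        S.1ᴹ i j (suc m) ∎
        where open Relation.Binary.Reasoning.Setoid setoid

      y′y≈1 : (y′ S.· y) S.≈ᴹ S.1ᴹ
      y′y≈1 i j zero = begin
        (y′ S.· y) i j 0  ≈⟨ pair-coef-zero (y′ i) (λ k → y k j) ⟩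
        (1ᴹ · 1ᴹ) i j     ≈⟨ ·-identityˡ 1ᴹ i j ⟩
        1ᴹ i j            ≈⟨ 1ᴹ-coef i j 0 ⟨
        S.1ᴹ i j 0        ∎
        where open Relation.Binary.Reasoning.Setoid setoid
      y′y≈1 i j (suc m) = begin
        (y′ S.· y) i j (suc m)
          ≈⟨ pair-coef-linearʳ (y′ i) {λ k → y k j} (λ k m → refl) m ⟩
        ((η ^ᴹ suc m) · 1ᴹ) i j + ((η ^ᴹ m) · (-ᴹ η)) i j
          -- Powers are built by multiplication on the left, whereas `y` stands on the right here,
          -- so one η has to change sides before the terms cancel.
          ≈⟨ +-cong (trans (·-identityʳ (η ^ᴹ suc m) i j) (^ᴹ-suc η m i j)) (pair-negʳ ((η ^ᴹ m) i) (λ k → η k j)) ⟩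
        (η ^ᴹ m · η) i j + - (η ^ᴹ m · η) i j
          ≈⟨ -‿inverseʳ _ ⟩
        0#
          ≈⟨ 1ᴹ-coef i j (suc m) ⟨
        S.1ᴹ i j (suc m) ∎
        where open Relation.Binary.Reasoning.Setoid setoid

      -- Over `R[[ε]]` the vector `e` is again the image of the integral one, so it must be
      -- identified with a constant series before coefficients can be read off.
      eS≈const : ∀ i → SE.eR i SR.≈ const (eR i)
      eS≈const i = SR.sym (BC.φ-fromℤ (e i))

      e*S≈const : ∀ i → SE.e*R i SR.≈ const (e*R i)
      e*S≈const i = SR.sym (BC.φ-fromℤ (e* i))

      ▹-eS : ∀ (x : S.Mat) i m → (x S.▹ SE.eR) i m ≈ (coefᴹ x m ▹ eR) i
      ▹-eS x i m = trans (SM.pair-cong {l = x i} (λ _ → SR.refl) eS≈const m) (pair-coef-constʳ (x i) eR m)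

      e*S-◃ : ∀ (x : S.Mat) j m → (SE.e*R S.◃ x) j m ≈ (e*R ◃ coefᴹ x m) j
      e*S-◃ x j m = trans (SM.pair-cong {v = λ i → x i j} e*S≈const (λ _ → SR.refl) m) (pair-coef-constˡ e*R (λ i → x i j) m)

      y▹e : (y S.▹ SE.eR) S.≈ᵛ SE.eR
      y▹e i m = trans (▹-eS y i m) (trans (coefs m) (sym (eS≈const i m)))
        where
        coefs : ∀ m → (coefᴹ y m ▹ eR) i ≈ const (eR i) m
        coefs zero          = ▹-identity eR i
        coefs (suc zero)    = trans (pair-negˡ (η i) eR) (trans (-‿cong (ηe≈0 i)) -0#≈0#)
        coefs (suc (suc m)) = pair-0ˡ eR (λ _ → refl)

      e*◃y : (SE.e*R S.◃ y) S.≈ᵛ SE.e*R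
      e*◃y j m = trans (e*S-◃ y j m) (trans (coefs m) (sym (e*S≈const j m)))
        where
        coefs : ∀ m → (e*R ◃ coefᴹ y m) j ≈ const (e*R j) m
        coefs zero          = ◃-identity e*R j
        coefs (suc zero)    = trans (pair-negʳ e*R (λ i → η i j)) (trans (-‿cong (e*η≈0 j)) -0#≈0#)
        coefs (suc (suc m)) = pair-0ʳ e*R (λ _ → refl)

      σS≈const : (SE._ᴴ (baseMat seriesAlgebra τ)) S.≈ᴹ baseMat seriesAlgebra (τ ᴴ)
      σS≈const = SM.≈ᴹ-sym (BC.φ-ᴴ e e* τ)

      yσ≈σy : (y S.· (SE._ᴴ (baseMat seriesAlgebra τ))) S.≈ᴹ ((SE._ᴴ (baseMat seriesAlgebra τ)) S.· y)
      yσ≈σy = SM.≈ᴹ-trans (SM.·-cong (SM.≈ᴹ-refl {y}) σS≈const) (SM.≈ᴹ-trans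
        (λ i j m → trans (pair-coef-constʳ (y i) (λ k → (τ ᴴ) k j) m)
          (trans (coefs m i j) (sym (pair-coef-constˡ ((τ ᴴ) i) (λ k → y k j) m))))
        (SM.·-cong (SM.≈ᴹ-sym σS≈const) (SM.≈ᴹ-refl {y})))
        where
        coefs : ∀ m → (coefᴹ y m · (τ ᴴ)) ≈ᴹ ((τ ᴴ) · coefᴹ y m)
        coefs zero              = ≈ᴹ-trans (·-identityˡ (τ ᴴ)) (≈ᴹ-sym (·-identityʳ (τ ᴴ)))
        coefs (suc zero)        = commutes-neg (τ ᴴ) ησ≈ση
        coefs (suc (suc m)) i j = trans (pair-0ˡ (λ k → (τ ᴴ) k j) (λ _ → refl)) (sym (pair-0ʳ ((τ ᴴ) i) (λ _ → refl)))

      aS a′S : S.Mat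
      aS  = baseMat seriesAlgebra a
      a′S = baseMat seriesAlgebra a′

      a′a≈1S : (a′S S.· aS) S.≈ᴹ S.1ᴹ
      a′a≈1S = SM.≈ᴹ-trans (SM.≈ᴹ-sym (BC.φ-· a′ a)) (SM.≈ᴹ-trans (λ i j → const-cong (a′a≈1 i j)) BC.φ-1ᴹ)

    module Coefficients (k k′ : S.Mat)
      (kτ≈τk : (k S.· baseMat seriesAlgebra τ) S.≈ᴹ (baseMat seriesAlgebra τ S.· k))
      (kk′≈1 : (k S.· k′) S.≈ᴹ S.1ᴹ) (k′k≈1 : (k′ S.· k) S.≈ᴹ S.1ᴹ)
      (e*k : (SE.e*R S.◃ k) S.≈ᵛ ((SE.e*R S.◃ aS) S.◃ y))
      (k′e : (k′ S.▹ SE.eR) S.≈ᵛ (y′ S.▹ (a′S S.▹ SE.eR))) where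
      k₀ k′₀ nk₁ : Mat
      k₀  = coefᴹ k 0
      k′₀ = coefᴹ k′ 0
      nk₁ = -ᴹ (coefᴹ k 1)

      k-comm : ∀ m → Commutes (coefᴹ k m)
      k-comm m i j = trans (sym (pair-coef-constʳ (k i) (λ i → τ i j) m))
        (trans (kτ≈τk i j m) (pair-coef-constˡ (τ i) (λ i → k i j) m))

      e*k-coef : ∀ m → (e*R ◃ coefᴹ k m) ≈ᵛ (l ◃ coefᴹ y m)
      e*k-coef m j = begin
        (e*R ◃ coefᴹ k m) j            ≈⟨ e*S-◃ k j m ⟨
        (SE.e*R S.◃ k) j m             ≈⟨ e*k j m ⟩
        ((SE.e*R S.◃ aS) S.◃ y) j m    ≈⟨ SM.pair-cong {v = λ i → y i j} lS≈const (λ _ → SR.refl) m ⟩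
        S.⟪ constᵛ l , (λ i → y i j) ⟫ m ≈⟨ pair-coef-constˡ l (λ i → y i j) m ⟩
        (l ◃ coefᴹ y m) j              ∎
        where
        open Relation.Binary.Reasoning.Setoid setoid
        lS≈const : ∀ j → (SE.e*R S.◃ aS) j SR.≈ const (l j)
        lS≈const j = SR.trans (SM.pair-cong {v = λ i → aS i j} e*S≈const (λ _ → SR.refl)) (SR.sym (BC.φ-pair e*R (λ i → a i j)))

      -- From ε² on the coefficients of `y` vanish, so `e*` annihilates those of `k`; they lie in
      -- the centralizer and are compared there with `0ᴹ`.
      k-linear : ∀ i j → Linear (k i j)
      k-linear i j m = cyclic-coext (proj₂ stable) (k-comm (suc (suc m))) commutes-0
        (λ j → trans (e*k-coef (suc (suc m)) j) (trans (pair-0ʳ l (λ _ → refl)) (sym (pair-0ʳ e*R (λ _ → refl))))) i j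

      k₀k′₀ : (k₀ · k′₀) ≈ᴹ 1ᴹ
      k₀k′₀ i j = trans (sym (pair-coef-zero (k i) (λ z → k′ z j))) (trans (kk′≈1 i j 0) (1ᴹ-coef i j 0))

      k′₀k₀ : (k′₀ · k₀) ≈ᴹ 1ᴹ
      k′₀k₀ i j = trans (sym (pair-coef-zero (k′ i) (λ z → k z j))) (trans (k′k≈1 i j 0) (1ᴹ-coef i j 0))

      -- The coefficient of `εᵐ⁺¹` in `kk′ = 1`; only two terms occur since `k` is linear.
      recursion : ∀ m → (k₀ · coefᴹ k′ (suc m)) ≈ᴹ (nk₁ · coefᴹ k′ m)
      recursion m i j = trans (+-inverseˡ-unique _ _ (begin
        (k₀ · coefᴹ k′ (suc m)) i j + (coefᴹ k 1 · coefᴹ k′ m) i j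
          ≈⟨ pair-coef-linearˡ {k i} (λ z → k′ z j) (λ z → k-linear i z) m ⟨
        (k S.· k′) i j (suc m)
          ≈⟨ kk′≈1 i j (suc m) ⟩
        S.1ᴹ i j (suc m)
          ≈⟨ 1ᴹ-coef i j (suc m) ⟩
        0# ∎)) (sym (pair-negˡ (coefᴹ k 1 i) (λ z → coefᴹ k′ m z j)))
        where open Relation.Binary.Reasoning.Setoid setoid

      k′e-coef : ∀ m → (coefᴹ k′ m ▹ eR) ≈ᵛ ((η ^ᴹ m) ▹ v)
      k′e-coef m i = begin
        (coefᴹ k′ m ▹ eR) i            ≈⟨ ▹-eS k′ i m ⟨
        (k′ S.▹ SE.eR) i m             ≈⟨ k′e i m ⟩
        (y′ S.▹ (a′S S.▹ SE.eR)) i m   ≈⟨ SM.pair-cong {l = y′ i} (λ _ → SR.refl) vS≈const m ⟩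
        S.⟪ y′ i , constᵛ v ⟫ m        ≈⟨ pair-coef-constʳ (y′ i) v m ⟩
        ((η ^ᴹ m) ▹ v) i               ∎
        where
        open Relation.Binary.Reasoning.Setoid setoid
        vS≈const : ∀ i → (a′S S.▹ SE.eR) i SR.≈ const (v i)
        vS≈const i = SR.trans (SM.pair-cong {l = a′S i} (λ _ → SR.refl) eS≈const) (SR.sym (BC.φ-pair (a′ i) eR))

      -- The vectors `ηᵐv` are the coefficients of `k′e`, so they inherit the recursion of `k′`;
      -- multiplying by `k′₀` solves it for the next one.
      step : ∀ m → ((η ^ᴹ suc m) ▹ v) ≈ᵛ ((k′₀ · nk₁) ▹ ((η ^ᴹ m) ▹ v))
      step m = begin
        (η ^ᴹ suc m) ▹ v                        ≈⟨ k′e-coef (suc m) ⟨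
        coefᴹ k′ (suc m) ▹ eR                   ≈⟨ ▹-cong (·-identityˡ _) ≈ᵛ-refl ⟨
        (1ᴹ · coefᴹ k′ (suc m)) ▹ eR            ≈⟨ ▹-cong (·-cong k′₀k₀ ≈ᴹ-refl) ≈ᵛ-refl ⟨
        ((k′₀ · k₀) · coefᴹ k′ (suc m)) ▹ eR    ≈⟨ ▹-cong (·-assoc _ _ _) ≈ᵛ-refl ⟩
        (k′₀ · (k₀ · coefᴹ k′ (suc m))) ▹ eR    ≈⟨ ▹-cong (·-cong ≈ᴹ-refl (recursion m)) ≈ᵛ-refl ⟩
        (k′₀ · (nk₁ · coefᴹ k′ m)) ▹ eR         ≈⟨ ▹-cong (·-assoc _ _ _) ≈ᵛ-refl ⟨
        ((k′₀ · nk₁) · coefᴹ k′ m) ▹ eR         ≈⟨ ▹-assoc _ _ _ ⟩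
        (k′₀ · nk₁) ▹ (coefᴹ k′ m ▹ eR)         ≈⟨ ▹-cong ≈ᴹ-refl (k′e-coef m) ⟩
        (k′₀ · nk₁) ▹ ((η ^ᴹ m) ▹ v)            ∎
        where open Vect-Reasoning

      -- The factor `k₀` cancels because `l` is `e*k₀`. What remains is `−e*k₁`, and the coefficient
      -- of ε in `e*k = ly` is `−lη`, so the signs cancel.
      ls : (l ◃ (k′₀ · nk₁)) ≈ᵛ (l ◃ η)
      ls = begin
        l ◃ (k′₀ · nk₁)                  ≈⟨ ◃-cong (≈ᵛ-trans (e*k-coef 0) (◃-identity l)) ≈ᴹ-refl ⟨
        (e*R ◃ k₀) ◃ (k′₀ · nk₁)         ≈⟨ ◃-assoc _ _ _ ⟩
        e*R ◃ (k₀ · (k′₀ · nk₁))         ≈⟨ ◃-cong ≈ᵛ-refl (·-assoc _ _ _) ⟨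
        e*R ◃ ((k₀ · k′₀) · nk₁)         ≈⟨ ◃-cong ≈ᵛ-refl (≈ᴹ-trans (·-cong k₀k′₀ ≈ᴹ-refl) (·-identityˡ nk₁)) ⟩
        e*R ◃ nk₁                        ≈⟨ (λ j → pair-negʳ e*R (λ i → coefᴹ k 1 i j)) ⟩
        (λ j → - (e*R ◃ coefᴹ k 1) j)    ≈⟨ (λ j → -‿cong (e*k-coef 1 j)) ⟩
        (λ j → - (l ◃ (-ᴹ η)) j)         ≈⟨ (λ j → -‿cong (pair-negʳ l (λ i → η i j))) ⟩
        (λ j → - - (l ◃ η) j)            ≈⟨ (λ j → -‿involutive _) ⟩
        l ◃ η                            ∎
        where open Vect-Reasoning

    deformation : ∃ λ s → Commutes s ×
      (∀ m → ((η ^ᴹ suc m) ▹ v) ≈ᵛ (s ▹ ((η ^ᴹ m) ▹ v))) × ((l ◃ s) ≈ᵛ (l ◃ η))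
    deformation =
      let k , k′ , kτ≈τk , kk′≈1 , k′k≈1 , e*k , k′e =
            Factorization.factorization seriesRing n e e* (baseMat seriesAlgebra τ) aS a′S y y′ a′a≈1S y′y≈1
              (proj₂ (H⊆X seriesAlgebra y (((y′ , yy′≈1 , y′y≈1) , y▹e , e*◃y) , yσ≈σy)))
          open Coefficients k k′ kτ≈τk kk′≈1 k′k≈1 e*k k′e
      in k′₀ · nk₁ , commutes-· (commutes-inverse k₀k′₀ k′₀k₀ (k-comm 0)) (commutes-neg τ (k-comm 1)) , step , ls

-- Subtraction-free identities in a commutative semiring with additive cancellation.

module CancellativeSemiring {c₀ ℓ₀ : Level} (C : CommutativeSemiring c₀ ℓ₀)
  (+-cancelˡ : LeftCancellative (CommutativeSemiring._≈_ C) (CommutativeSemiring._+_ C)) where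
  open CommutativeSemiring C hiding (zero)
  open Algebra.Solver.Ring.NaturalCoefficients.Default C using (solve; _:+_; _:*_; _:=_)
  open Relation.Binary.Reasoning.Setoid setoid

  -- aI = aP for a matrix P of rank at most 2; six of the nine entries suffice to conclude a = 0.
  rank-two-minor : ∀ a (x y e f : Fin 3 → Carrier) →
    let P = λ (i j : Fin 3) → x i * e j + y i * f j in
    a * P 0F 0F ≈ a → a * P 0F 1F ≈ 0# →
    a * P 1F 1F ≈ a →
    a * P 2F 0F ≈ 0# → a * P 2F 1F ≈ 0# → a * P 2F 2F ≈ a →
    a ≈ 0#
  rank-two-minor a x y e f P00 P01 P11 P20 P21 P22 = a≈0
    where
    x0 = x 0F ; x1 = x 1F ; x2 = x 2F
    y0 = y 0F ; y1 = y 1F ; y2 = y 2F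
    e0 = e 0F ; e1 = e 1F ; e2 = e 2F
    f0 = f 0F ; f1 = f 1F ; f2 = f 2F

    -- The expansion of a 3 × 3 determinant with last row P₂ and equal rows e, f above it is zero.
    ae0f1≈ae1f0 : a * (e0 * f1) ≈ a * (e1 * f0)
    ae0f1≈ae1f0 = begin
      a * (e0 * f1)
        ≈⟨ *-congʳ P22 ⟨
      a * (x2 * e2 + y2 * f2) * (e0 * f1)
        ≈⟨ trans (+-cong (+-congˡ (kill P20)) (kill P21)) (trans (+-identityʳ _) (+-identityʳ _)) ⟨
      a * (x2 * e2 + y2 * f2) * (e0 * f1) + a * (x2 * e0 + y2 * f0) * (e1 * f2) + a * (x2 * e1 + y2 * f1) * (e2 * f0)
        ≈⟨ solve 9 (λ a x y e0 e1 e2 f0 f1 f2 →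
             a :* (x :* e2 :+ y :* f2) :* (e0 :* f1) :+ a :* (x :* e0 :+ y :* f0) :* (e1 :* f2) :+ a :* (x :* e1 :+ y :* f1) :* (e2 :* f0)
             := a :* (x :* e2 :+ y :* f2) :* (e1 :* f0) :+ a :* (x :* e0 :+ y :* f0) :* (e2 :* f1) :+ a :* (x :* e1 :+ y :* f1) :* (e0 :* f2))
             refl a x2 y2 e0 e1 e2 f0 f1 f2 ⟩
      a * (x2 * e2 + y2 * f2) * (e1 * f0) + a * (x2 * e0 + y2 * f0) * (e2 * f1) + a * (x2 * e1 + y2 * f1) * (e0 * f2)
        ≈⟨ trans (+-cong (+-congˡ (kill P20)) (kill P21)) (trans (+-identityʳ _) (+-identityʳ _)) ⟩
      a * (x2 * e2 + y2 * f2) * (e1 * f0)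
        ≈⟨ *-congʳ P22 ⟩
      a * (e1 * f0) ∎
      where
      kill : ∀ {u w} → u ≈ 0# → u * w ≈ 0#
      kill p = trans (*-congʳ p) (zeroˡ _)

    -- The upper left minor `P₀₀P₁₁ − P₀₁P₁₀` factors as `(x₀y₁ − x₁y₀)(e₀f₁ − e₁f₀)`. `Z′` and `Z`
    -- are the positive and negative parts of a times this product; they agree by `ae0f1≈ae1f0`,
    -- whereas a times the minor is a.
    Z Z′ : Carrier
    Z  = x0 * y1 * (a * (e1 * f0)) + x1 * y0 * (a * (e0 * f1))
    Z′ = x0 * y1 * (a * (e0 * f1)) + x1 * y0 * (a * (e1 * f0))

    a≈0 : a ≈ 0#
    a≈0 = +-cancelˡ Z a 0# (begin
      Z + a
        ≈⟨ +-congˡ (trans (*-congʳ P00) P11) ⟨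
      Z + a * (x0 * e0 + y0 * f0) * (x1 * e1 + y1 * f1)
        ≈⟨ solve 9 (λ a x0 x1 y0 y1 e0 e1 f0 f1 →
             x0 :* y1 :* (a :* (e1 :* f0)) :+ x1 :* y0 :* (a :* (e0 :* f1)) :+ a :* (x0 :* e0 :+ y0 :* f0) :* (x1 :* e1 :+ y1 :* f1)
             := x0 :* y1 :* (a :* (e0 :* f1)) :+ x1 :* y0 :* (a :* (e1 :* f0)) :+ a :* (x0 :* e1 :+ y0 :* f1) :* (x1 :* e0 :+ y1 :* f0))
             refl a x0 x1 y0 y1 e0 e1 f0 f1 ⟩
      Z′ + a * (x0 * e1 + y0 * f1) * (x1 * e0 + y1 * f0)
        ≈⟨ +-cong (+-cong (*-congˡ ae0f1≈ae1f0) (*-congˡ (sym ae0f1≈ae1f0))) (trans (*-congʳ P01) (zeroˡ _)) ⟩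
      Z + 0# ∎)

  -- The case η = `1H` in abstract form, with `A`, `B` for the scalars α, β. Multiplication by t and
  -- by t′ exhibits the complement of f both as `A * t` and as `B * t′`.
  module Idempotent {f t t′ A B} (ft′+A : f * t′ + A ≈ t′) (tf+B : t * f + B ≈ t)
    (fft′ : f * (f * t′) ≈ f * t′) (tt′≈1 : t * t′ ≈ 1#) where

    f+At : f + A * t ≈ 1#
    f+At = begin
      f + A * t                ≈⟨ +-congʳ (*-identityʳ f) ⟨
      f * 1# + A * t           ≈⟨ +-congʳ (*-congˡ tt′≈1) ⟨
      f * (t * t′) + A * t     ≈⟨ solve 4 (λ f t t′ A → f :* (t :* t′) :+ A :* t := t :* (f :* t′ :+ A)) refl f t t′ A ⟩
      t * (f * t′ + A)         ≈⟨ *-congˡ ft′+A ⟩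
      t * t′                   ≈⟨ tt′≈1 ⟩
      1#                       ∎

    f+Bt′ : f + B * t′ ≈ 1#
    f+Bt′ = begin
      f + B * t′               ≈⟨ +-congʳ (*-identityʳ f) ⟨
      f * 1# + B * t′          ≈⟨ +-congʳ (*-congˡ tt′≈1) ⟨
      f * (t * t′) + B * t′    ≈⟨ solve 4 (λ f t t′ B → f :* (t :* t′) :+ B :* t′ := (t :* f :+ B) :* t′) refl f t t′ B ⟩
      (t * f + B) * t′         ≈⟨ *-congʳ tf+B ⟩
      t * t′                   ≈⟨ tt′≈1 ⟩
      1#                       ∎

    ff≈f : f * f ≈ f
    ff≈f = begin
      f * f                    ≈⟨ *-identityʳ _ ⟨
      f * f * 1#               ≈⟨ *-congˡ tt′≈1 ⟨
      f * f * (t * t′)         ≈⟨ solve 3 (λ f t t′ → f :* f :* (t :* t′) := t :* (f :* (f :* t′))) refl f t t′ ⟩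
      t * (f * (f * t′))       ≈⟨ *-congˡ fft′ ⟩
      t * (f * t′)             ≈⟨ solve 3 (λ f t t′ → t :* (f :* t′) := f :* (t :* t′)) refl f t t′ ⟩
      f * (t * t′)             ≈⟨ *-congˡ tt′≈1 ⟩
      f * 1#                   ≈⟨ *-identityʳ f ⟩
      f                        ∎

    private
      f-annihilates : ∀ {x} → f + x ≈ 1# → f * x ≈ 0#
      f-annihilates {x} f+x≈1 = +-cancelˡ f _ _ (begin
        f + f * x      ≈⟨ +-congʳ ff≈f ⟨
        f * f + f * x  ≈⟨ distribˡ f f x ⟨
        f * (f + x)    ≈⟨ *-congˡ f+x≈1 ⟩
        f * 1#         ≈⟨ *-identityʳ f ⟩
        f              ≈⟨ +-identityʳ f ⟨
        f + 0#         ∎)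

    fA≈0 : f * A ≈ 0#
    fA≈0 = begin
      f * A             ≈⟨ *-identityʳ _ ⟨
      f * A * 1#        ≈⟨ *-congˡ tt′≈1 ⟨
      f * A * (t * t′)  ≈⟨ solve 4 (λ f A t t′ → f :* A :* (t :* t′) := f :* (A :* t) :* t′) refl f A t t′ ⟩
      f * (A * t) * t′  ≈⟨ *-congʳ (f-annihilates f+At) ⟩
      0# * t′           ≈⟨ zeroˡ t′ ⟩
      0#                ∎

    fB≈0 : f * B ≈ 0#
    fB≈0 = begin
      f * B             ≈⟨ *-identityʳ _ ⟨
      f * B * 1#        ≈⟨ *-congˡ tt′≈1 ⟨
      f * B * (t * t′)  ≈⟨ solve 4 (λ f B t t′ → f :* B :* (t :* t′) := f :* (B :* t′) :* t) refl f B t t′ ⟩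
      f * (B * t′) * t  ≈⟨ *-congʳ (f-annihilates f+Bt′) ⟩
      0# * t            ≈⟨ zeroˡ t ⟩
      0#                ∎

    -- The product of `f + At = 1` and `f + Bt′ = 1`: the mixed terms die and t meets t′. Thus t is
    -- eliminated, and f is expressed by scalars.
    f+AB : f + A * B ≈ 1#
    f+AB = begin
      f + A * B
        ≈⟨ +-congˡ (*-identityʳ _) ⟨
      f + A * B * 1#
        ≈⟨ +-cong ff≈f (*-congˡ tt′≈1) ⟨
      f * f + A * B * (t * t′)
        ≈⟨ +-cong (+-identityʳ _) refl ⟨
      f * f + 0# + A * B * (t * t′)
        ≈⟨ +-congʳ (+-congˡ (trans (+-cong (kill fA≈0) (kill fB≈0)) (+-identityʳ 0#))) ⟨
      f * f + (f * A * t + f * B * t′) + A * B * (t * t′)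
        ≈⟨ solve 5 (λ f A B t t′ → f :* f :+ (f :* A :* t :+ f :* B :* t′) :+ A :* B :* (t :* t′) := (f :+ A :* t) :* (f :+ B :* t′)) refl f A B t t′ ⟩
      (f + A * t) * (f + B * t′)
        ≈⟨ *-cong f+At f+Bt′ ⟩
      1# * 1#
        ≈⟨ *-identityʳ 1# ⟩
      1# ∎
      where
      kill : ∀ {u w} → u ≈ 0# → u * w ≈ 0#
      kill p = trans (*-congʳ p) (zeroˡ _)

    At≈AB : A * t ≈ A * B
    At≈AB = +-cancelˡ f _ _ (trans f+At (sym f+AB))

    Bt′≈AB : B * t′ ≈ A * B
    Bt′≈AB = +-cancelˡ f _ _ (trans f+Bt′ (sym f+AB))

  -- The case η = σ in abstract form: `F`, `T`, `c`, `d`, `Γ′` stand for p, τ, γ, δ, γ′. Of the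
  -- three relations, `b1` and `b3` come from evaluation at `e`, and `b2` from evaluation at `e*`.
  module Relations {F s t t′ T c d Γ′} (Fc≈c : F * c ≈ c) (tt′≈1 : t * t′ ≈ 1#)
    (b1 : F * (s * t′) + c ≈ F * (T * t′))
    (b2 : F * (t * s) + d ≈ F * (t * T))
    (b3 : s * (s * t′) + Γ′ ≈ T * (s * t′)) where

    private
      cancel-tt′ : ∀ x → x * (t * t′) ≈ x
      cancel-tt′ x = trans (*-congˡ tt′≈1) (*-identityʳ x)

    Fs+ct : F * s + c * t ≈ F * T
    Fs+ct = begin
      F * s + c * t                  ≈⟨ +-congʳ (cancel-tt′ _) ⟨
      F * s * (t * t′) + c * t   ≈⟨ solve 5 (λ F s c t t′ → F :* s :* (t :* t′) :+ c :* t := (F :* (s :* t′) :+ c) :* t) refl F s c t t′ ⟩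
      (F * (s * t′) + c) * t     ≈⟨ *-congʳ b1 ⟩
      F * (T * t′) * t               ≈⟨ solve 4 (λ F T t t′ → F :* (T :* t′) :* t := F :* T :* (t :* t′)) refl F T t t′ ⟩
      F * T * (t * t′)               ≈⟨ cancel-tt′ _ ⟩
      F * T                          ∎

    Fs+dt′ : F * s + d * t′ ≈ F * T
    Fs+dt′ = begin
      F * s + d * t′                  ≈⟨ +-congʳ (cancel-tt′ _) ⟨
      F * s * (t * t′) + d * t′   ≈⟨ solve 5 (λ F s d t t′ → F :* s :* (t :* t′) :+ d :* t′ := (F :* (t :* s) :+ d) :* t′) refl F s d t t′ ⟩
      (F * (t * s) + d) * t′      ≈⟨ *-congʳ b2 ⟩
      F * (t * T) * t′                ≈⟨ solve 4 (λ F T t t′ → F :* (t :* T) :* t′ := F :* T :* (t :* t′)) refl F T t t′ ⟩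
      F * T * (t * t′)                ≈⟨ cancel-tt′ _ ⟩
      F * T                           ∎

    -- The defect between `F * T` and `F * s` is `c * t` by `b1` and `d * t′` by `b2`. Consequently
    -- γt² is a scalar, which is what makes the relation for τ quadratic.
    ctt≈d : c * t * t ≈ d
    ctt≈d = begin
      c * t * t      ≈⟨ *-congʳ (+-cancelˡ (F * s) _ _ (trans Fs+ct (sym Fs+dt′))) ⟩
      d * t′ * t     ≈⟨ solve 3 (λ d t t′ → d :* t′ :* t := d :* (t :* t′)) refl d t t′ ⟩
      d * (t * t′)   ≈⟨ cancel-tt′ d ⟩
      d              ∎

    ss+Γ′t : s * s + Γ′ * t ≈ T * s
    ss+Γ′t = begin
      s * s + Γ′ * t                ≈⟨ +-congʳ (cancel-tt′ _) ⟨
      s * s * (t * t′) + Γ′ * t     ≈⟨ solve 4 (λ s Γ′ t t′ → s :* s :* (t :* t′) :+ Γ′ :* t := (s :* (s :* t′) :+ Γ′) :* t) refl s Γ′ t t′ ⟩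
      (s * (s * t′) + Γ′) * t       ≈⟨ *-congʳ b3 ⟩
      T * (s * t′) * t              ≈⟨ solve 4 (λ T s t t′ → T :* (s :* t′) :* t := T :* s :* (t :* t′)) refl T s t t′ ⟩
      T * s * (t * t′)              ≈⟨ cancel-tt′ _ ⟩
      T * s                         ∎

    -- `F * T * s` is computed in two ways, from `Fs+ct` and from `ss+Γ′t`; the common term
    -- `F * (s * s)` and the unit t are then cancelled.
    cs≈FΓ′ : c * s ≈ F * Γ′
    cs≈FΓ′ = begin
      c * s               ≈⟨ cancel-tt′ _ ⟨
      c * s * (t * t′)    ≈⟨ solve 4 (λ c s t t′ → c :* s :* (t :* t′) := c :* t :* s :* t′) refl c s t t′ ⟩
      c * t * s * t′      ≈⟨ *-congʳ (+-cancelˡ (F * (s * s)) _ _ (begin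
        F * (s * s) + c * t * s     ≈⟨ solve 4 (λ F s c t → F :* (s :* s) :+ c :* t :* s := (F :* s :+ c :* t) :* s) refl F s c t ⟩
        (F * s + c * t) * s         ≈⟨ *-congʳ Fs+ct ⟩
        F * T * s                   ≈⟨ *-assoc _ _ _ ⟩
        F * (T * s)                 ≈⟨ *-congˡ ss+Γ′t ⟨
        F * (s * s + Γ′ * t)        ≈⟨ distribˡ _ _ _ ⟩
        F * (s * s) + F * (Γ′ * t)  ∎)) ⟩
      F * (Γ′ * t) * t′   ≈⟨ solve 4 (λ F Γ′ t t′ → F :* (Γ′ :* t) :* t′ := F :* Γ′ :* (t :* t′)) refl F Γ′ t t′ ⟩
      F * Γ′ * (t * t′)   ≈⟨ cancel-tt′ _ ⟩
      F * Γ′              ∎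

    FΓ′+cct : F * Γ′ + c * c * t ≈ c * T
    FΓ′+cct = begin
      F * Γ′ + c * c * t        ≈⟨ +-congʳ cs≈FΓ′ ⟨
      c * s + c * c * t         ≈⟨ +-congʳ (*-congʳ Fc≈c) ⟨
      F * c * s + c * c * t     ≈⟨ solve 4 (λ F c s t → F :* c :* s :+ c :* c :* t := c :* (F :* s :+ c :* t)) refl F c s t ⟩
      c * (F * s + c * t)       ≈⟨ *-congˡ Fs+ct ⟩
      c * (F * T)               ≈⟨ solve 3 (λ F c T → c :* (F :* T) := F :* c :* T) refl F c T ⟩
      F * c * T                 ≈⟨ *-congʳ Fc≈c ⟩
      c * T                     ∎

    -- The square of `c(T − Θ) = c²t` with the negative term moved across. The right side would be
    -- `c⁴t²`, and `ctt≈d` removes t from it.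
    quadratic : ∀ {Θ} → c * Θ ≈ F * Γ′ →
      c * c * (T * T) + c * c * (Θ * Θ) ≈ c * c * ((Θ + Θ) * T) + c * c * (c * d)
    quadratic {Θ} cΘ≈FΓ′ = begin
      c * c * (T * T) + c * c * (Θ * Θ)
        ≈⟨ solve 3 (λ c T Θ → c :* c :* (T :* T) :+ c :* c :* (Θ :* Θ) := c :* T :* (c :* T) :+ c :* Θ :* (c :* Θ)) refl c T Θ ⟩
      c * T * (c * T) + c * Θ * (c * Θ)
        ≈⟨ +-congʳ (*-cong cT cT) ⟩
      (c * Θ + c * c * t) * (c * Θ + c * c * t) + c * Θ * (c * Θ)
        ≈⟨ solve 3 (λ c Θ t → (c :* Θ :+ c :* c :* t) :* (c :* Θ :+ c :* c :* t) :+ c :* Θ :* (c :* Θ)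
             := c :* (Θ :+ Θ) :* (c :* Θ :+ c :* c :* t) :+ c :* c :* (c :* (c :* t :* t))) refl c Θ t ⟩
      c * (Θ + Θ) * (c * Θ + c * c * t) + c * c * (c * (c * t * t))
        ≈⟨ +-cong (*-congˡ (sym cT)) (*-congˡ (*-congˡ ctt≈d)) ⟩
      c * (Θ + Θ) * (c * T) + c * c * (c * d)
        ≈⟨ +-congʳ (solve 3 (λ c T Θ → c :* (Θ :+ Θ) :* (c :* T) := c :* c :* ((Θ :+ Θ) :* T)) refl c T Θ) ⟩
      c * c * ((Θ + Θ) * T) + c * c * (c * d) ∎
      where
      cT : c * T ≈ c * Θ + c * c * t
      cT = trans (sym FΓ′+cct) (+-congʳ (sym cΘ≈FΓ′))

-- Quadratic relations for τ at a cyclic vector.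

module QuadraticRelation {c ℓ : Level} (R : CommutativeRing c ℓ) (n : ℕ)
  (τ : LinAlg.Mat R n) (v : LinAlg.Vect R n) where
  open CommutativeRing R hiding (zero)
  open LinAlg R n
  open MatrixProperties R n
  open Algebra.Solver.Ring.NaturalCoefficients.Default commutativeSemiring using (solve; _:+_; _:*_; _:=_)
  open Relation.Binary.Reasoning.Setoid setoid

  module Span (a u w : Carrier) (cyclic : CyclicVec τ v)
    (relation : ∀ i → a * (τ ▹ (τ ▹ v)) i ≈ a * (w * v i + u * (τ ▹ v) i)) where

    -- The multiplier a stays on both sides because it may be a zero divisor.
    InSpan : Vect → Set (c ⊔ ℓ)
    InSpan z = ∃ λ x → ∃ λ y → ∀ i → a * z i ≈ a * (x * v i + y * (τ ▹ v) i)

    span-τ : ∀ {z} → InSpan z → InSpan (τ ▹ z)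
    -- The new coefficients are given by the companion matrix of `X² = uX + w`.
    span-τ {z} (x , y , az≈) = y * w , x + y * u , λ i → begin
      a * (τ ▹ z) i
        ≈⟨ ▹-·ᵛ τ a z i ⟨
      (τ ▹ (a ·ᵛ z)) i
        ≈⟨ ▹-cong (≈ᴹ-refl {τ}) az≈ i ⟩
      (τ ▹ (a ·ᵛ ((x ·ᵛ v) +ᵛ (y ·ᵛ (τ ▹ v))))) i
        ≈⟨ ▹-·ᵛ τ a ((x ·ᵛ v) +ᵛ (y ·ᵛ (τ ▹ v))) i ⟩
      a * (τ ▹ ((x ·ᵛ v) +ᵛ (y ·ᵛ (τ ▹ v)))) i
        ≈⟨ *-congˡ (trans (▹-+ τ (x ·ᵛ v) (y ·ᵛ (τ ▹ v)) i) (+-cong (▹-·ᵛ τ x v i) (▹-·ᵛ τ y (τ ▹ v) i))) ⟩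
      a * (x * (τ ▹ v) i + y * (τ ▹ (τ ▹ v)) i)
        ≈⟨ solve 5 (λ a x y p q → a :* (x :* p :+ y :* q) := a :* (x :* p) :+ y :* (a :* q)) refl a x y ((τ ▹ v) i) ((τ ▹ (τ ▹ v)) i) ⟩
      a * (x * (τ ▹ v) i) + y * (a * (τ ▹ (τ ▹ v)) i)
        ≈⟨ +-congˡ (*-congˡ (relation i)) ⟩
      a * (x * (τ ▹ v) i) + y * (a * (w * v i + u * (τ ▹ v) i))
        ≈⟨ solve 7 (λ a x y u w p q → a :* (x :* p) :+ y :* (a :* (w :* q :+ u :* p)) := a :* (y :* w :* q :+ (x :+ y :* u) :* p)) refl a x y u w ((τ ▹ v) i) (v i) ⟩
      a * (y * w * v i + (x + y * u) * (τ ▹ v) i) ∎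

    span-polyAct : ∀ as {z} → InSpan z → InSpan (polyAct as τ z)
    span-polyAct []       s = 0# , 0# , λ i → *-congˡ (sym (trans (+-cong (zeroˡ _) (zeroˡ _)) (+-identityʳ 0#)))
    span-polyAct (b ∷ as) {z} s@(x , y , az≈) =
      let x′ , y′ , eq = span-polyAct as (span-τ {z} s) in b * x + x′ , b * y + y′ , λ i → begin
      a * (b * z i + polyAct as τ (τ ▹ z) i)
        ≈⟨ solve 4 (λ a b p q → a :* (b :* p :+ q) := b :* (a :* p) :+ a :* q) refl a b (z i) (polyAct as τ (τ ▹ z) i) ⟩
      b * (a * z i) + a * polyAct as τ (τ ▹ z) i
        ≈⟨ +-cong (*-congˡ (az≈ i)) (eq i) ⟩
      b * (a * (x * v i + y * (τ ▹ v) i)) + a * (x′ * v i + y′ * (τ ▹ v) i)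
        ≈⟨ solve 8 (λ a b x y x′ y′ p q → b :* (a :* (x :* p :+ y :* q)) :+ a :* (x′ :* p :+ y′ :* q)
             := a :* ((b :* x :+ x′) :* p :+ (b :* y :+ y′) :* q)) refl a b x y x′ y′ (v i) ((τ ▹ v) i) ⟩
      a * ((b * x + x′) * v i + (b * y + y′) * (τ ▹ v) i) ∎

    span-all : ∀ z → InSpan z
    span-all z =
      let p , pv≈z = cyclic z
          x , y , eq = span-polyAct p {v} (1# , 0# , λ i → *-congˡ (sym (trans (+-cong (*-identityˡ _) (zeroˡ _)) (+-identityʳ _))))
      in x , y , λ i → trans (*-congˡ (sym (pv≈z i))) (eq i)

-- Cyclicity spreads the relation to all vectors, so after multiplication by a every standard basis
-- vector is a combination of `v` and `τv`. Three of them give a 3 × 3 identity matrix that, up to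
-- the factor a, passes through R².
quadratic-relation-trivial : ∀ {c ℓ} (R : CommutativeRing c ℓ) {n} → n ≥ 3 →
  let open CommutativeRing R
      open LinAlg R n
  in ∀ τ v → CyclicVec τ v → ∀ a u w →
     (∀ i → a * (τ ▹ (τ ▹ v)) i ≈ a * (w * v i + u * (τ ▹ v) i)) → a ≈ 0#
quadratic-relation-trivial R {n} (s≤s (s≤s (s≤s _))) τ v cyclic a u w relation =
  CancellativeSemiring.rank-two-minor commutativeSemiring +-cancelˡ a
    (λ i → proj₁ (span (emb i))) (λ i → proj₁ (proj₂ (span (emb i))))
    (λ j → v (emb j)) (λ j → (τ ▹ v) (emb j))
    (trans (entry 0F 0F) (*-identityʳ a)) (trans (entry 0F 1F) (zeroʳ a))
    (trans (entry 1F 1F) (*-identityʳ a))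
    (trans (entry 2F 0F) (zeroʳ a)) (trans (entry 2F 1F) (zeroʳ a))
    (trans (entry 2F 2F) (*-identityʳ a))
  where
  open CommutativeRing R hiding (zero)
  open Algebra.Properties.Ring ring using (+-cancelˡ)
  open LinAlg R n
  open QuadraticRelation.Span R n τ v a u w cyclic relation using (InSpan; span-all)
  -- Matching on `n ≥ 3` has put n in the form 3 + m. The embedding computes on numerals, so the
  -- entries of `1ᴹ` used above reduce to `1#` or `0#`.
  emb : Fin 3 → Fin n
  emb i = i Fin.↑ˡ _
  span : ∀ i → InSpan (1ᴹ i)
  span i = span-all (1ᴹ i)
  entry : ∀ i j → a * (proj₁ (span (emb i)) * v (emb j) + proj₁ (proj₂ (span (emb i))) * (τ ▹ v) (emb j)) ≈ a * 1ᴹ (emb i) (emb j)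
  entry i j = sym (proj₂ (proj₂ (span (emb i))) (emb j))

-- The projection `1H` and the compression `τ ᴴ`.

module Projection {c ℓ : Level} (R : CommutativeRing c ℓ) (n : ℕ) (e e* : Fin n → ℤ)
  (e*e≈1 : CommutativeRing._≈_ R
    (LinAlg.⟪_,_⟫ R n (LinAlg.WithE.e*R R n e e*) (LinAlg.WithE.eR R n e e*)) (CommutativeRing.1# R)) where
  open CommutativeRing R hiding (zero)
  open LinAlg R n
  open WithE e e*
  open MatrixProperties R n
  open Algebra.Properties.Ring ring using (+-cancelʳ)

  private
    x-y+y : ∀ x y → x - y + y ≈ x
    x-y+y x y = trans (+-assoc _ _ _) (trans (+-congˡ (-‿inverseˡ y)) (+-identityʳ x))

    absorb : ∀ {x y u} → x + u * y ≈ y → u ≈ 1# → x ≈ 0#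
    absorb {x} {y} {u} p q = +-cancelʳ (u * y) _ _
      (trans p (sym (trans (+-identityˡ _) (trans (*-congʳ q) (*-identityˡ y)))))

  -- The splitting of V into V_H and Re. With its dual `◃-1H` it is the source of all scalar terms
  -- in the relations below: each is the component that the projection removes.
  1H-▹ : ∀ w → ((1H ▹ w) +ᵛ (⟪ e*R , w ⟫ ·ᵛ eR)) ≈ᵛ w
  1H-▹ w i = begin
    ⟪ 1H i , w ⟫ + ⟪ e*R , w ⟫ * eR i   ≈⟨ +-congˡ (trans (*-comm _ _) (sym (pair-·ˡ (eR i) e*R w))) ⟩
    ⟪ 1H i , w ⟫ + ⟪ eR i ·ᵛ e*R , w ⟫  ≈⟨ pair-+ˡ (1H i) (eR i ·ᵛ e*R) w ⟨
    ⟪ 1H i +ᵛ (eR i ·ᵛ e*R) , w ⟫       ≈⟨ pair-cong {v = w} (λ j → x-y+y (1ᴹ i j) (eR i * e*R j)) (λ _ → refl) ⟩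
    ⟪ 1ᴹ i , w ⟫                        ≈⟨ ▹-identity w i ⟩
    w i                                 ∎
    where open Relation.Binary.Reasoning.Setoid setoid

  ◃-1H : ∀ l → ((l ◃ 1H) +ᵛ (⟪ l , eR ⟫ ·ᵛ e*R)) ≈ᵛ l
  ◃-1H l j = begin
    (l ◃ 1H) j + ⟪ l , eR ⟫ * e*R j                   ≈⟨ +-congˡ (trans (*-comm _ _) (sym (pair-·ʳ l (e*R j) eR))) ⟩
    (l ◃ 1H) j + ⟪ l , e*R j ·ᵛ eR ⟫                  ≈⟨ pair-+ʳ l (λ i → 1H i j) (e*R j ·ᵛ eR) ⟨
    ⟪ l , (λ i → 1H i j) +ᵛ (e*R j ·ᵛ eR) ⟫           ≈⟨ pair-cong {l = l} (λ _ → refl) (λ i → trans (+-congˡ (*-comm _ _)) (x-y+y (1ᴹ i j) (eR i * e*R j))) ⟩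
    (l ◃ 1ᴹ) j                                        ≈⟨ ◃-identity l j ⟩
    l j                                               ∎
    where open Relation.Binary.Reasoning.Setoid setoid

  1H-e : (1H ▹ eR) ≈ᵛ 0ᵛ
  1H-e i = absorb (1H-▹ eR i) e*e≈1

  e*-1H : (e*R ◃ 1H) ≈ᵛ 0ᵛ
  e*-1H j = absorb (◃-1H e*R j) e*e≈1

  1H-idem : (1H · 1H) ≈ᴹ 1H
  1H-idem = ▹-ext λ w i → begin
    ((1H · 1H) ▹ w) i                                    ≈⟨ ▹-assoc 1H 1H w i ⟩
    (1H ▹ (1H ▹ w)) i                                    ≈⟨ +-identityʳ _ ⟨
    (1H ▹ (1H ▹ w)) i + 0#                               ≈⟨ +-congˡ (trans (*-congʳ (e*1Hw w)) (zeroˡ _)) ⟨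
    (1H ▹ (1H ▹ w)) i + ⟪ e*R , 1H ▹ w ⟫ * eR i          ≈⟨ 1H-▹ (1H ▹ w) i ⟩
    (1H ▹ w) i                                           ∎
    where
    open Relation.Binary.Reasoning.Setoid setoid
    e*1Hw : ∀ w → ⟪ e*R , 1H ▹ w ⟫ ≈ 0#
    e*1Hw w = trans (sym (Σ-assoc e*R 1H w)) (pair-0ˡ w e*-1H)

  module _ (τ : Mat) where
    1H-ᴴ : (1H · (τ ᴴ)) ≈ᴹ (τ ᴴ)
    1H-ᴴ = ≈ᴹ-trans (≈ᴹ-sym (·-assoc 1H (1H · τ) 1H)) (·-cong
      (≈ᴹ-trans (≈ᴹ-sym (·-assoc 1H 1H τ)) (·-cong 1H-idem (≈ᴹ-refl {τ}))) (≈ᴹ-refl {1H}))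

    ᴴ-1H : ((τ ᴴ) · 1H) ≈ᴹ (τ ᴴ)
    ᴴ-1H = ≈ᴹ-trans (·-assoc (1H · τ) 1H 1H) (·-cong (≈ᴹ-refl {1H · τ}) 1H-idem)

    ᴴ-▹ : ∀ w → ((τ ᴴ) ▹ w) ≈ᵛ (1H ▹ (τ ▹ (1H ▹ w)))
    ᴴ-▹ w = ≈ᵛ-trans (▹-assoc (1H · τ) 1H w) (▹-assoc 1H τ (1H ▹ w))

    ◃-ᴴ : ∀ l → (l ◃ (τ ᴴ)) ≈ᵛ (((l ◃ 1H) ◃ τ) ◃ 1H)
    ◃-ᴴ l = ≈ᵛ-sym (≈ᵛ-trans (◃-cong (◃-assoc l 1H τ) (≈ᴹ-refl {1H})) (◃-assoc l (1H · τ) 1H))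

    ᴴ-e : ((τ ᴴ) ▹ eR) ≈ᵛ 0ᵛ
    ᴴ-e = ≈ᵛ-trans (ᴴ-▹ eR) (▹-0 1H (▹-0 τ 1H-e))

    e*-ᴴ : (e*R ◃ (τ ᴴ)) ≈ᵛ 0ᵛ
    e*-ᴴ = ≈ᵛ-trans (◃-ᴴ e*R) (0-◃ 1H (0-◃ τ e*-1H))

-- The unit t, the deformations f and s, and the case η = `1H`.

module Rigidity {c ℓ : Level} (R : CommutativeRing c ℓ) (n : ℕ) (e e* : Fin n → ℤ)
  (e*e≈1 : CommutativeRing._≈_ R
    (LinAlg.⟪_,_⟫ R n (LinAlg.WithE.e*R R n e e*) (LinAlg.WithE.eR R n e e*)) (CommutativeRing.1# R))
  (n≥3 : n ≥ 3) (τ a a′ : LinAlg.Mat R n)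
  (stable : LinAlg.WithE.Stable R n e e* τ)
  (aa′≈1 : LinAlg._≈ᴹ_ R n (LinAlg._·_ R n a a′) (LinAlg.1ᴹ R n))
  (a′a≈1 : LinAlg._≈ᴹ_ R n (LinAlg._·_ R n a′ a) (LinAlg.1ᴹ R n))
  (H⊆X : (A : Algebra R c ℓ) (y : LinAlg.Mat (Algebra.ring A) n) →
    LinAlg.WithE.InHcent (Algebra.ring A) n e e* (LinAlg.WithE._ᴴ (Algebra.ring A) n e e* (baseMat A τ)) y →
    LinAlg.WithE.InX (Algebra.ring A) n e e* (baseMat A τ) (baseMat A a) y) where
  open CommutativeRing R hiding (zero)
  open LinAlg R n
  open WithE e e*
  open MatrixProperties R n
  open Cyclic R n τ
  open Centralizer R n τ eR (proj₁ stable)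
  open Projection R n e e* e*e≈1
  open Deformation R n e e* τ a a′ stable aa′≈1 a′a≈1 H⊆X
  open Algebra.Properties.Ring ring using (+-cancelʳ)

  identityAlgebra : Algebra R c ℓ
  identityAlgebra = record
    { ring  = R
    ; φ     = λ u → u
    ; isHom = Algebra.Morphism.Construct.Identity.isRingHomomorphism rawRing refl
    }

  base : ∃ λ t → ∃ λ t′ → Commutes t × ((t · t′) ≈ᴹ 1ᴹ) × ((t′ · t) ≈ᴹ 1ᴹ) ×
    ((e*R ◃ t) ≈ᵛ (l ◃ 1ᴹ)) × ((t′ ▹ eR) ≈ᵛ (1ᴹ ▹ v))
  base = Factorization.factorization R n e e* τ a a′ 1ᴹ 1ᴹ a′a≈1 (·-identityˡ 1ᴹ)
    (proj₂ (H⊆X identityAlgebra 1ᴹ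
      ( ((1ᴹ , ·-identityˡ 1ᴹ , ·-identityˡ 1ᴹ) , ▹-identity eR , ◃-identity e*R)
      , ≈ᴹ-trans (·-identityˡ (τ ᴴ)) (≈ᴹ-sym (·-identityʳ (τ ᴴ))))))

  t t′ : Mat
  t  = proj₁ base
  t′ = proj₁ (proj₂ base)

  t-comm : Commutes t
  t-comm = proj₁ (proj₂ (proj₂ base))

  tt′≈1 : (t · t′) ≈ᴹ 1ᴹ
  tt′≈1 = proj₁ (proj₂ (proj₂ (proj₂ base)))

  t′t≈1 : (t′ · t) ≈ᴹ 1ᴹ
  t′t≈1 = proj₁ (proj₂ (proj₂ (proj₂ (proj₂ base))))

  e*t≈l : (e*R ◃ t) ≈ᵛ l
  e*t≈l = ≈ᵛ-trans (proj₁ (proj₂ (proj₂ (proj₂ (proj₂ (proj₂ base)))))) (◃-identity l)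

  t′e≈v : (t′ ▹ eR) ≈ᵛ v
  t′e≈v = ≈ᵛ-trans (proj₂ (proj₂ (proj₂ (proj₂ (proj₂ (proj₂ base)))))) (▹-identity v)

  t′-comm : Commutes t′
  t′-comm = commutes-inverse tt′≈1 t′t≈1 t-comm

  σ : Mat
  σ = τ ᴴ

  deformation₁ : ∃ λ f → Commutes f × (∀ m → ((1H ^ᴹ suc m) ▹ v) ≈ᵛ (f ▹ ((1H ^ᴹ m) ▹ v))) × ((l ◃ f) ≈ᵛ (l ◃ 1H))
  deformation₁ = deformation 1H (≈ᴹ-trans (1H-ᴴ τ) (≈ᴹ-sym (ᴴ-1H τ))) 1H-e e*-1H

  deformationσ : ∃ λ s → Commutes s × (∀ m → ((σ ^ᴹ suc m) ▹ v) ≈ᵛ (s ▹ ((σ ^ᴹ m) ▹ v))) × ((l ◃ s) ≈ᵛ (l ◃ σ))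
  deformationσ = deformation σ (≈ᴹ-refl {σ · σ}) (ᴴ-e τ) (e*-ᴴ τ)

  f s : Mat
  f = proj₁ deformation₁
  s = proj₁ deformationσ

  f-comm : Commutes f
  f-comm = proj₁ (proj₂ deformation₁)

  s-comm : Commutes s
  s-comm = proj₁ (proj₂ deformationσ)

  module _ (η z : Mat) (step : ∀ m → ((η ^ᴹ suc m) ▹ v) ≈ᵛ (z ▹ ((η ^ᴹ m) ▹ v))) where
    first-power : (η ▹ v) ≈ᵛ (z ▹ v)
    first-power = ≈ᵛ-trans (▹-cong (≈ᴹ-sym (·-identityʳ η)) (≈ᵛ-refl {v}))
      (≈ᵛ-trans (step 0) (▹-cong (≈ᴹ-refl {z}) (▹-identity v)))

    -- The relation at `m = 1`, which is beyond first order in ε. It yields the idempotence of f and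
    -- the relation `b3`.
    second-power : (η ▹ (η ▹ v)) ≈ᵛ (z ▹ (η ▹ v))
    second-power = ≈ᵛ-trans (▹-cong (≈ᴹ-refl {η}) (≈ᵛ-sym η1v))
      (≈ᵛ-trans (≈ᵛ-sym (▹-assoc η (η · 1ᴹ) v)) (≈ᵛ-trans (step 1) (▹-cong (≈ᴹ-refl {z}) η1v)))
      where
      η1v : ((η · 1ᴹ) ▹ v) ≈ᵛ (η ▹ v)
      η1v = ▹-cong (·-identityʳ η) (≈ᵛ-refl {v})

  1Hv≈fv : (1H ▹ v) ≈ᵛ (f ▹ v)
  1Hv≈fv = first-power 1H f (proj₁ (proj₂ (proj₂ deformation₁)))

  σv≈sv : (σ ▹ v) ≈ᵛ (s ▹ v)
  σv≈sv = first-power σ s (proj₁ (proj₂ (proj₂ deformationσ)))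

  α β : Carrier
  α = ⟪ e*R , v ⟫
  β = ⟪ l , eR ⟫

  at-e : ∀ x → ((x · t′) ▹ eR) ≈ᵛ (x ▹ v)
  at-e x = ≈ᵛ-trans (▹-assoc x t′ eR) (▹-cong (≈ᴹ-refl {x}) t′e≈v)

  at-e* : ∀ x → (e*R ◃ (t · x)) ≈ᵛ (l ◃ x)
  at-e* x = ≈ᵛ-trans (≈ᵛ-sym (◃-assoc e*R t x)) (◃-cong e*t≈l (≈ᴹ-refl {x}))

  -- Both sides lie in the centralizer, so it suffices to compare them at `e`, where t′ gives v and
  -- `fv = 1Hv` differs from v by αe.
  ft′+α : ((f · t′) +ᴹ scal α) ≈ᴹ t′
  ft′+α = cyclic-ext (proj₁ stable) (commutes-+ (commutes-· f-comm t′-comm) (scal-central α τ)) t′-comm (begin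
    ((f · t′) +ᴹ scal α) ▹ eR             ≈⟨ +-▹ (f · t′) (scal α) eR ⟩
    ((f · t′) ▹ eR) +ᵛ (scal α ▹ eR)      ≈⟨ (λ i → +-cong (trans (at-e f i) (sym (1Hv≈fv i))) (scal-▹ α eR i)) ⟩
    (1H ▹ v) +ᵛ (α ·ᵛ eR)                 ≈⟨ 1H-▹ v ⟩
    v                                     ≈⟨ t′e≈v ⟨
    t′ ▹ eR                               ∎)
    where open Vect-Reasoning

  tf+β : ((t · f) +ᴹ scal β) ≈ᴹ t
  tf+β = cyclic-coext (proj₂ stable) (commutes-+ (commutes-· t-comm f-comm) (scal-central β τ)) t-comm (begin
    e*R ◃ ((t · f) +ᴹ scal β)             ≈⟨ ◃-+ e*R (t · f) (scal β) ⟩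
    (e*R ◃ (t · f)) +ᵛ (e*R ◃ scal β)     ≈⟨ (λ j → +-cong (trans (at-e* f j) (proj₂ (proj₂ (proj₂ deformation₁)) j)) (◃-scal e*R β j)) ⟩
    (l ◃ 1H) +ᵛ (β ·ᵛ e*R)                ≈⟨ ◃-1H l ⟩
    l                                     ≈⟨ e*t≈l ⟨
    e*R ◃ t                               ∎)
    where open Vect-Reasoning

  fft′ : (f · (f · t′)) ≈ᴹ (f · t′)
  fft′ = cyclic-ext (proj₁ stable) (commutes-· f-comm (commutes-· f-comm t′-comm)) (commutes-· f-comm t′-comm) (begin
    (f · (f · t′)) ▹ eR   ≈⟨ ▹-assoc f (f · t′) eR ⟩
    f ▹ ((f · t′) ▹ eR)   ≈⟨ ▹-cong (≈ᴹ-refl {f}) (≈ᵛ-trans (at-e f) (≈ᵛ-sym 1Hv≈fv)) ⟩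
    f ▹ (1H ▹ v)          ≈⟨ second-power 1H f (proj₁ (proj₂ (proj₂ deformation₁))) ⟨
    1H ▹ (1H ▹ v)         ≈⟨ ▹-assoc 1H 1H v ⟨
    (1H · 1H) ▹ v         ≈⟨ ▹-cong 1H-idem (≈ᵛ-refl {v}) ⟩
    1H ▹ v                ≈⟨ 1Hv≈fv ⟩
    f ▹ v                 ≈⟨ at-e f ⟨
    (f · t′) ▹ eR         ∎)
    where open Vect-Reasoning

  private
    module C = CancellativeSemiring centralizer centralizer-cancelˡ
    module I = C.Idempotent {f , f-comm} {t , t-comm} {t′ , t′-comm} {scalar α} {scalar β} ft′+α tf+β fft′ tt′≈1

  -- The coefficient `e* x e`. It recovers u from `scal u`, and so turns equations between matrices
  -- into equations in R.
  ev : Mat → Carrier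
  ev x = ⟪ e*R , x ▹ eR ⟫

  ev-cong : ∀ x y → x ≈ᴹ y → ev x ≈ ev y
  ev-cong x y p = pair-cong (λ _ → refl) (▹-cong p (≈ᵛ-refl {eR}))

  ev-scal-· : ∀ u x → ev (scal u · x) ≈ u * ev x
  ev-scal-· u x = trans (pair-cong {l = e*R} (λ _ → refl) (≈ᵛ-trans (▹-assoc (scal u) x eR) (scal-▹ u (x ▹ eR)))) (pair-·ʳ e*R u (x ▹ eR))

  ev-scal : ∀ u → ev (scal u) ≈ u
  ev-scal u = trans (pair-cong {l = e*R} (λ _ → refl) (scal-▹ u eR)) (trans (pair-·ʳ e*R u eR) (trans (*-congˡ e*e≈1) (*-identityʳ u)))

  ev-0 : ev 0ᴹ ≈ 0#
  ev-0 = pair-0ʳ e*R (λ _ → pair-0ˡ eR (λ _ → refl))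

  p : Carrier
  p = 1# - α * β

  p+αβ≈1 : p + α * β ≈ 1#
  p+αβ≈1 = trans (+-assoc _ _ _) (trans (+-congˡ (-‿inverseˡ _)) (+-identityʳ 1#))

  scal-p≈f : scal p ≈ᴹ f
  scal-p≈f i j = +-cancelʳ (scal (α * β) i j) _ _ (begin
    scal p i j + scal (α * β) i j      ≈⟨ scalar-+ p (α * β) i j ⟨
    scal (p + α * β) i j               ≈⟨ trans (scalar-cong p+αβ≈1 i j) (scalar-1 i j) ⟩
    1ᴹ i j                             ≈⟨ I.f+AB i j ⟨
    f i j + (scal α · scal β) i j      ≈⟨ +-congˡ (scalar-* α β i j) ⟨
    f i j + scal (α * β) i j           ∎)
    where open Relation.Binary.Reasoning.Setoid setoid

  p*-zero : ∀ u → (f · scal u) ≈ᴹ 0ᴹ → p * u ≈ 0#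
  p*-zero u fu≈0 = begin
    p * u                ≈⟨ *-congˡ (ev-scal u) ⟨
    p * ev (scal u)      ≈⟨ ev-scal-· p (scal u) ⟨
    ev (scal p · scal u) ≈⟨ ev-cong (scal p · scal u) 0ᴹ (≈ᴹ-trans (·-cong scal-p≈f (≈ᴹ-refl {scal u})) fu≈0) ⟩
    ev 0ᴹ                ≈⟨ ev-0 ⟩
    0#                   ∎
    where open Relation.Binary.Reasoning.Setoid setoid

  pα≈0 : p * α ≈ 0#
  pα≈0 = p*-zero α I.fA≈0

  pβ≈0 : p * β ≈ 0#
  pβ≈0 = p*-zero β I.fB≈0

  pp≈p : p * p ≈ p
  pp≈p = begin
    p * p                    ≈⟨ +-identityʳ _ ⟨
    p * p + 0#               ≈⟨ +-congˡ (trans (sym (*-assoc _ _ _)) (trans (*-congʳ pα≈0) (zeroˡ β))) ⟨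
    p * p + p * (α * β)      ≈⟨ distribˡ _ _ _ ⟨
    p * (p + α * β)          ≈⟨ *-congˡ p+αβ≈1 ⟩
    p * 1#                   ≈⟨ *-identityʳ p ⟩
    p                        ∎
    where open Relation.Binary.Reasoning.Setoid setoid

  -- The case η = σ and the vanishing of γ.

  -- Up to the factor p, γ and δ are the components of `τv` along `e` and of `lτ` along `e*` that
  -- are lost when σ replaces τ. The factor p is built in so that `pγ = γ`. γ′ is the component lost
  -- at the second application of σ to v.
  γ δ γ′ θ : Carrier
  γ  = p * ⟪ e*R , τ ▹ v ⟫
  δ  = p * ⟪ l ◃ τ , eR ⟫
  γ′ = ⟪ e*R , τ ▹ (σ ▹ v) ⟫
  θ  = ev τ

  -- As `pα = 0`, the vector pv already lies in V_H. This removes the inner projection from `pσv`,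
  -- and dually for `l` with `pβ = 0`.
  p1Hv : (p ·ᵛ (1H ▹ v)) ≈ᵛ (p ·ᵛ v)
  p1Hv i = begin
    p * (1H ▹ v) i                     ≈⟨ +-identityʳ _ ⟨
    p * (1H ▹ v) i + 0#                ≈⟨ +-congˡ (trans (sym (*-assoc _ _ _)) (trans (*-congʳ pα≈0) (zeroˡ _))) ⟨
    p * (1H ▹ v) i + p * (α * eR i)    ≈⟨ distribˡ _ _ _ ⟨
    p * ((1H ▹ v) i + α * eR i)        ≈⟨ *-congˡ (1H-▹ v i) ⟩
    p * v i                            ∎
    where open Relation.Binary.Reasoning.Setoid setoid

  pl1H : (p ·ᵛ (l ◃ 1H)) ≈ᵛ (p ·ᵛ l)
  pl1H j = begin
    p * (l ◃ 1H) j                     ≈⟨ +-identityʳ _ ⟨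
    p * (l ◃ 1H) j + 0#                ≈⟨ +-congˡ (trans (sym (*-assoc _ _ _)) (trans (*-congʳ pβ≈0) (zeroˡ _))) ⟨
    p * (l ◃ 1H) j + p * (β * e*R j)   ≈⟨ distribˡ _ _ _ ⟨
    p * ((l ◃ 1H) j + β * e*R j)       ≈⟨ *-congˡ (◃-1H l j) ⟩
    p * l j                            ∎
    where open Relation.Binary.Reasoning.Setoid setoid

  pσv : (p ·ᵛ (σ ▹ v)) ≈ᵛ (p ·ᵛ (1H ▹ (τ ▹ v)))
  pσv = begin
    p ·ᵛ (σ ▹ v)                       ≈⟨ (λ i → *-congˡ (ᴴ-▹ τ v i)) ⟩
    p ·ᵛ (1H ▹ (τ ▹ (1H ▹ v)))         ≈⟨ ▹-·ᵛ 1H p (τ ▹ (1H ▹ v)) ⟨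
    1H ▹ (p ·ᵛ (τ ▹ (1H ▹ v)))         ≈⟨ ▹-cong (≈ᴹ-refl {1H}) (▹-·ᵛ τ p (1H ▹ v)) ⟨
    1H ▹ (τ ▹ (p ·ᵛ (1H ▹ v)))         ≈⟨ ▹-cong (≈ᴹ-refl {1H}) (▹-cong (≈ᴹ-refl {τ}) p1Hv) ⟩
    1H ▹ (τ ▹ (p ·ᵛ v))                ≈⟨ ▹-cong (≈ᴹ-refl {1H}) (▹-·ᵛ τ p v) ⟩
    1H ▹ (p ·ᵛ (τ ▹ v))                ≈⟨ ▹-·ᵛ 1H p (τ ▹ v) ⟩
    p ·ᵛ (1H ▹ (τ ▹ v))                ∎
    where open Vect-Reasoning

  plσ : (p ·ᵛ (l ◃ σ)) ≈ᵛ (p ·ᵛ ((l ◃ τ) ◃ 1H))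
  plσ = begin
    p ·ᵛ (l ◃ σ)                       ≈⟨ (λ i → *-congˡ (◃-ᴴ τ l i)) ⟩
    p ·ᵛ (((l ◃ 1H) ◃ τ) ◃ 1H)         ≈⟨ ·ᵛ-◃ p ((l ◃ 1H) ◃ τ) 1H ⟨
    (p ·ᵛ ((l ◃ 1H) ◃ τ)) ◃ 1H         ≈⟨ ◃-cong (·ᵛ-◃ p (l ◃ 1H) τ) (≈ᴹ-refl {1H}) ⟨
    ((p ·ᵛ (l ◃ 1H)) ◃ τ) ◃ 1H         ≈⟨ ◃-cong (◃-cong pl1H (≈ᴹ-refl {τ})) (≈ᴹ-refl {1H}) ⟩
    ((p ·ᵛ l) ◃ τ) ◃ 1H                ≈⟨ ◃-cong (·ᵛ-◃ p l τ) (≈ᴹ-refl {1H}) ⟩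
    (p ·ᵛ (l ◃ τ)) ◃ 1H                ≈⟨ ·ᵛ-◃ p (l ◃ τ) 1H ⟩
    p ·ᵛ ((l ◃ τ) ◃ 1H)                ∎
    where open Vect-Reasoning

  p-distrib : ∀ x y z w → x + y * z ≈ w → p * x + p * y * z ≈ p * w
  p-distrib x y z w eq = trans (+-congˡ (*-assoc p y z)) (trans (sym (distribˡ p x (y * z))) (*-congˡ eq))

  b1 : ((scal p · (s · t′)) +ᴹ scal γ) ≈ᴹ (scal p · (τ · t′))
  b1 = cyclic-ext (proj₁ stable)
    (commutes-+ (commutes-· (scal-central p τ) (commutes-· s-comm t′-comm)) (scal-central γ τ))
    (commutes-· (scal-central p τ) (commutes-· (≈ᴹ-refl {τ · τ}) t′-comm)) (begin
    ((scal p · (s · t′)) +ᴹ scal γ) ▹ eR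
      ≈⟨ +-▹ (scal p · (s · t′)) (scal γ) eR ⟩
    ((scal p · (s · t′)) ▹ eR) +ᵛ (scal γ ▹ eR)
      ≈⟨ (λ i → +-cong (trans (▹-assoc (scal p) (s · t′) eR i) (scal-▹ p ((s · t′) ▹ eR) i)) (scal-▹ γ eR i)) ⟩
    (p ·ᵛ ((s · t′) ▹ eR)) +ᵛ (γ ·ᵛ eR)
      ≈⟨ (λ i → +-congʳ (trans (*-congˡ (trans (at-e s i) (sym (σv≈sv i)))) (pσv i))) ⟩
    (p ·ᵛ (1H ▹ (τ ▹ v))) +ᵛ (γ ·ᵛ eR)
      ≈⟨ (λ i → p-distrib _ _ _ _ (1H-▹ (τ ▹ v) i)) ⟩
    p ·ᵛ (τ ▹ v)
      ≈⟨ (λ i → *-congˡ (at-e τ i)) ⟨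
    p ·ᵛ ((τ · t′) ▹ eR)
      ≈⟨ scal-▹ p ((τ · t′) ▹ eR) ⟨
    scal p ▹ ((τ · t′) ▹ eR)
      ≈⟨ ▹-assoc (scal p) (τ · t′) eR ⟨
    (scal p · (τ · t′)) ▹ eR ∎)
    where open Vect-Reasoning

  e*-scal : ∀ u x → (e*R ◃ (scal u · (t · x))) ≈ᵛ (u ·ᵛ (l ◃ x))
  e*-scal u x = begin
    e*R ◃ (scal u · (t · x))    ≈⟨ ◃-assoc e*R (scal u) (t · x) ⟨
    (e*R ◃ scal u) ◃ (t · x)    ≈⟨ ◃-cong (◃-scal e*R u) (≈ᴹ-refl {t · x}) ⟩
    (u ·ᵛ e*R) ◃ (t · x)        ≈⟨ ·ᵛ-◃ u e*R (t · x) ⟩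
    u ·ᵛ (e*R ◃ (t · x))        ≈⟨ (λ j → *-congˡ (at-e* x j)) ⟩
    u ·ᵛ (l ◃ x)                ∎
    where open Vect-Reasoning

  b2 : ((scal p · (t · s)) +ᴹ scal δ) ≈ᴹ (scal p · (t · τ))
  b2 = cyclic-coext (proj₂ stable)
    (commutes-+ (commutes-· (scal-central p τ) (commutes-· t-comm s-comm)) (scal-central δ τ))
    (commutes-· (scal-central p τ) (commutes-· t-comm (≈ᴹ-refl {τ · τ}))) (begin
    e*R ◃ ((scal p · (t · s)) +ᴹ scal δ)
      ≈⟨ ◃-+ e*R (scal p · (t · s)) (scal δ) ⟩
    (e*R ◃ (scal p · (t · s))) +ᵛ (e*R ◃ scal δ)
      ≈⟨ (λ j → +-cong (e*-scal p s j) (◃-scal e*R δ j)) ⟩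
    (p ·ᵛ (l ◃ s)) +ᵛ (δ ·ᵛ e*R)
      ≈⟨ (λ j → +-congʳ (trans (*-congˡ (proj₂ (proj₂ (proj₂ deformationσ)) j)) (plσ j))) ⟩
    (p ·ᵛ ((l ◃ τ) ◃ 1H)) +ᵛ (δ ·ᵛ e*R)
      ≈⟨ (λ j → p-distrib _ _ _ _ (◃-1H (l ◃ τ) j)) ⟩
    p ·ᵛ (l ◃ τ)
      ≈⟨ e*-scal p τ ⟨
    e*R ◃ (scal p · (t · τ)) ∎)
    where open Vect-Reasoning

  b3 : ((s · (s · t′)) +ᴹ scal γ′) ≈ᴹ (τ · (s · t′))
  b3 = cyclic-ext (proj₁ stable)
    (commutes-+ (commutes-· s-comm (commutes-· s-comm t′-comm)) (scal-central γ′ τ))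
    (commutes-· (≈ᴹ-refl {τ · τ}) (commutes-· s-comm t′-comm)) (begin
    ((s · (s · t′)) +ᴹ scal γ′) ▹ eR
      ≈⟨ +-▹ (s · (s · t′)) (scal γ′) eR ⟩
    ((s · (s · t′)) ▹ eR) +ᵛ (scal γ′ ▹ eR)
      ≈⟨ (λ i → +-cong (trans (▹-assoc s (s · t′) eR i) (▹-cong (≈ᴹ-refl {s}) st′e i)) (scal-▹ γ′ eR i)) ⟩
    (s ▹ (σ ▹ v)) +ᵛ (γ′ ·ᵛ eR)
      ≈⟨ (λ i → +-congʳ (trans (sym (second-power σ s (proj₁ (proj₂ (proj₂ deformationσ))) i)) (σσv i))) ⟩
    (1H ▹ (τ ▹ (σ ▹ v))) +ᵛ (γ′ ·ᵛ eR)
      ≈⟨ 1H-▹ (τ ▹ (σ ▹ v)) ⟩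
    τ ▹ (σ ▹ v)
      ≈⟨ ▹-cong (≈ᴹ-refl {τ}) st′e ⟨
    τ ▹ ((s · t′) ▹ eR)
      ≈⟨ ▹-assoc τ (s · t′) eR ⟨
    (τ · (s · t′)) ▹ eR ∎)
    where
    open Vect-Reasoning
    st′e : ((s · t′) ▹ eR) ≈ᵛ (σ ▹ v)
    st′e = ≈ᵛ-trans (at-e s) (≈ᵛ-sym σv≈sv)
    -- The inner projection disappears without the help of p, since `σv` lies in V_H.
    σσv : (σ ▹ (σ ▹ v)) ≈ᵛ (1H ▹ (τ ▹ (σ ▹ v)))
    σσv = ≈ᵛ-trans (ᴴ-▹ τ (σ ▹ v)) (▹-cong (≈ᴹ-refl {1H}) (▹-cong (≈ᴹ-refl {τ})
      (≈ᵛ-trans (≈ᵛ-sym (▹-assoc 1H σ v)) (▹-cong (1H-ᴴ τ) (≈ᵛ-refl {v})))))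

  pγ≈γ : p * γ ≈ γ
  pγ≈γ = trans (sym (*-assoc _ _ _)) (*-congʳ pp≈p)

  private
    module L = C.Relations {scalar p} {s , s-comm} {t , t-comm} {t′ , t′-comm} {τ , ≈ᴹ-refl {τ · τ}}
      {scalar γ} {scalar δ} {scalar γ′}
      (≈ᴹ-trans (≈ᴹ-sym (scalar-* p γ)) (scalar-cong pγ≈γ)) tt′≈1 b1 b2 b3

  γβ≈0 : γ * β ≈ 0#
  γβ≈0 = begin
    p * ⟪ e*R , τ ▹ v ⟫ * β    ≈⟨ trans (*-assoc _ _ _) (trans (*-congˡ (*-comm _ _)) (sym (*-assoc _ _ _))) ⟩
    p * β * ⟪ e*R , τ ▹ v ⟫    ≈⟨ trans (*-congʳ pβ≈0) (zeroˡ _) ⟩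
    0#                         ∎
    where open Relation.Binary.Reasoning.Setoid setoid

  -- The coefficient `e*(·)e` of `FΓ′+cct`. The term in t contributes γ²β, which vanishes because γ
  -- is a multiple of p and `pβ = 0`.
  γθ≈pγ′ : γ * θ ≈ p * γ′
  γθ≈pγ′ = begin
    γ * θ                                                       ≈⟨ ev-scal-· γ τ ⟨
    ev (scal γ · τ)                                             ≈⟨ ev-cong ((scal p · scal γ′) +ᴹ ((scal γ · scal γ) · t)) (scal γ · τ) L.FΓ′+cct ⟨
    ev ((scal p · scal γ′) +ᴹ ((scal γ · scal γ) · t))          ≈⟨ pair-cong {l = e*R} (λ _ → refl) (+-▹ (scal p · scal γ′) ((scal γ · scal γ) · t) eR) ⟩
    ⟪ e*R , ((scal p · scal γ′) ▹ eR) +ᵛ (((scal γ · scal γ) · t) ▹ eR) ⟫ ≈⟨ pair-+ʳ e*R ((scal p · scal γ′) ▹ eR) (((scal γ · scal γ) · t) ▹ eR) ⟩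
    ev (scal p · scal γ′) + ev ((scal γ · scal γ) · t)          ≈⟨ +-cong (trans (ev-scal-· p (scal γ′)) (*-congˡ (ev-scal γ′)))
                                                                     (trans (ev-cong ((scal γ · scal γ) · t) (scal (γ * γ) · t) (·-cong (≈ᴹ-sym (scalar-* γ γ)) (≈ᴹ-refl {t}))) (ev-scal-· (γ * γ) t)) ⟩
    p * γ′ + γ * γ * ev t                                       ≈⟨ +-congˡ (*-congˡ (trans (sym (Σ-assoc e*R t eR)) (pair-cong e*t≈l (λ _ → refl)))) ⟩
    p * γ′ + γ * γ * β                                          ≈⟨ +-congˡ (trans (*-assoc _ _ _) (trans (*-congˡ γβ≈0) (zeroʳ γ))) ⟩
    p * γ′ + 0#                                                 ≈⟨ +-identityʳ _ ⟩
    p * γ′                                                      ∎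
    where open Relation.Binary.Reasoning.Setoid setoid

  private
    γθ≈pγ′ᴹ : (scal γ · scal θ) ≈ᴹ (scal p · scal γ′)
    γθ≈pγ′ᴹ = ≈ᴹ-trans (≈ᴹ-sym (scalar-* γ θ)) (≈ᴹ-trans (scalar-cong γθ≈pγ′) (scalar-* p γ′))

    scal²-▹ : ∀ u w x z → (((scal u · scal w) · x) ▹ z) ≈ᵛ ((u * w) ·ᵛ (x ▹ z))
    scal²-▹ u w x z = ≈ᵛ-trans (▹-cong (·-cong (≈ᴹ-sym (scalar-* u w)) (≈ᴹ-refl {x})) (≈ᵛ-refl {z}))
      (≈ᵛ-trans (▹-assoc (scal (u * w)) x z) (scal-▹ (u * w) (x ▹ z)))

    scal²-▹-scal : ∀ u w z → ((scal u · scal w) ▹ z) ≈ᵛ ((u * w) ·ᵛ z)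
    scal²-▹-scal u w z = ≈ᵛ-trans (▹-cong (≈ᴹ-sym (scalar-* u w)) (≈ᵛ-refl {z})) (scal-▹ (u * w) z)

    quadratic-e : ∀ i → γ * γ * (τ ▹ (τ ▹ eR)) i + γ * γ * (θ * θ * eR i) ≈
      γ * γ * ((θ + θ) * (τ ▹ eR) i) + γ * γ * (γ * δ * eR i)
    quadratic-e i = begin
      γ * γ * (τ ▹ (τ ▹ eR)) i + γ * γ * (θ * θ * eR i)
        ≈⟨ +-cong (*-congˡ (▹-assoc τ τ eR i)) (*-congˡ (scal²-▹-scal θ θ eR i)) ⟨
      γ * γ * ((τ · τ) ▹ eR) i + γ * γ * ((scal θ · scal θ) ▹ eR) i
        ≈⟨ +-cong (scal²-▹ γ γ (τ · τ) eR i) (scal²-▹ γ γ (scal θ · scal θ) eR i) ⟨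
      (x₁ ▹ eR) i + (x₂ ▹ eR) i
        ≈⟨ +-▹ x₁ x₂ eR i ⟨
      ((x₁ +ᴹ x₂) ▹ eR) i
        ≈⟨ ▹-cong (L.quadratic {scalar θ} γθ≈pγ′ᴹ) (≈ᵛ-refl {eR}) i ⟩
      ((x₃ +ᴹ x₄) ▹ eR) i
        ≈⟨ +-▹ x₃ x₄ eR i ⟩
      (x₃ ▹ eR) i + (x₄ ▹ eR) i
        ≈⟨ +-cong (scal²-▹ γ γ ((scal θ +ᴹ scal θ) · τ) eR i) (scal²-▹ γ γ (scal γ · scal δ) eR i) ⟩
      γ * γ * (((scal θ +ᴹ scal θ) · τ) ▹ eR) i + γ * γ * ((scal γ · scal δ) ▹ eR) i
        ≈⟨ +-cong (*-congˡ 2θτe) (*-congˡ (scal²-▹-scal γ δ eR i)) ⟩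
      γ * γ * ((θ + θ) * (τ ▹ eR) i) + γ * γ * (γ * δ * eR i) ∎
      where
      open Relation.Binary.Reasoning.Setoid setoid
      x₁ x₂ x₃ x₄ : Mat
      x₁ = (scal γ · scal γ) · (τ · τ)
      x₂ = (scal γ · scal γ) · (scal θ · scal θ)
      x₃ = (scal γ · scal γ) · ((scal θ +ᴹ scal θ) · τ)
      x₄ = (scal γ · scal γ) · (scal γ · scal δ)
      2θτe : (((scal θ +ᴹ scal θ) · τ) ▹ eR) i ≈ (θ + θ) * (τ ▹ eR) i
      2θτe = trans (▹-assoc (scal θ +ᴹ scal θ) τ eR i)
        (trans (▹-cong (≈ᴹ-sym (scalar-+ θ θ)) (≈ᵛ-refl {τ ▹ eR}) i) (scal-▹ (θ + θ) (τ ▹ eR) i))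

  γγ≈0 : γ * γ ≈ 0#
  -- Up to the factor γ², the relation reads `(τ − θ)² = γδ` at `e`, hence u = 2θ and w = γδ - θ².
  γγ≈0 = quadratic-relation-trivial R n≥3 τ eR (proj₁ stable) (γ * γ) (θ + θ) (γ * δ - θ * θ) λ i →
    +-cancelʳ (γ * γ * (θ * θ * eR i)) _ _ (trans (quadratic-e i) (sym (begin
      γ * γ * ((γ * δ - θ * θ) * eR i + (θ + θ) * (τ ▹ eR) i) + γ * γ * (θ * θ * eR i)
        ≈⟨ solve 5 (λ a x y z w → a :* (x :* z :+ w) :+ a :* (y :* z) := a :* w :+ a :* ((x :+ y) :* z)) refl
             (γ * γ) (γ * δ - θ * θ) (θ * θ) (eR i) ((θ + θ) * (τ ▹ eR) i) ⟩
      γ * γ * ((θ + θ) * (τ ▹ eR) i) + γ * γ * ((γ * δ - θ * θ + θ * θ) * eR i)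
        ≈⟨ +-congˡ (*-congˡ (*-congʳ (trans (+-assoc _ _ _) (trans (+-congˡ (-‿inverseˡ _)) (+-identityʳ _))))) ⟩
      γ * γ * ((θ + θ) * (τ ▹ eR) i) + γ * γ * (γ * δ * eR i) ∎)))
    where
    open Relation.Binary.Reasoning.Setoid setoid
    open Algebra.Solver.Ring.NaturalCoefficients.Default commutativeSemiring using (solve; _:+_; _:*_; _:=_)

  γτ≈γθ : (scal γ · τ) ≈ᴹ (scal γ · scal θ)
  γτ≈γθ = ≈ᴹ-trans (≈ᴹ-sym L.FΓ′+cct) (≈ᴹ-trans (λ i j → trans (+-congˡ (γγt≈0 i j)) (+-identityʳ _)) (≈ᴹ-sym γθ≈pγ′ᴹ))
    where
    γγt≈0 : ((scal γ · scal γ) · t) ≈ᴹ 0ᴹ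
    γγt≈0 i j = trans (·-cong (≈ᴹ-trans (≈ᴹ-sym (scalar-* γ γ)) (scalar-cong γγ≈0)) (≈ᴹ-refl {t}) i j)
      (trans (scal-· 0# t i j) (zeroˡ _))

  γ≈0 : γ ≈ 0#
  -- Here w = 0 and u = θ: the relation `γτ = γθ`, applied to `τe`, is read as a degenerate
  -- quadratic one.
  γ≈0 = quadratic-relation-trivial R n≥3 τ eR (proj₁ stable) γ θ 0# λ i → begin
    γ * (τ ▹ (τ ▹ eR)) i                ≈⟨ scal-▹ γ (τ ▹ (τ ▹ eR)) i ⟨
    (scal γ ▹ (τ ▹ (τ ▹ eR))) i         ≈⟨ ▹-assoc (scal γ) τ (τ ▹ eR) i ⟨
    ((scal γ · τ) ▹ (τ ▹ eR)) i         ≈⟨ ▹-cong γτ≈γθ (≈ᵛ-refl {τ ▹ eR}) i ⟩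
    ((scal γ · scal θ) ▹ (τ ▹ eR)) i    ≈⟨ scal²-▹-scal γ θ (τ ▹ eR) i ⟩
    γ * θ * (τ ▹ eR) i                  ≈⟨ *-assoc _ _ _ ⟩
    γ * (θ * (τ ▹ eR) i)                ≈⟨ *-congˡ (trans (+-congʳ (zeroˡ _)) (+-identityˡ _)) ⟨
    γ * (0# * eR i + θ * (τ ▹ eR) i)    ∎
    where open Relation.Binary.Reasoning.Setoid setoid

  ps≈pτ : ∀ x → (p ·ᵛ (s ▹ x)) ≈ᵛ (p ·ᵛ (τ ▹ x))
  ps≈pτ x = begin
    p ·ᵛ (s ▹ x)             ≈⟨ scal-▹ p (s ▹ x) ⟨
    scal p ▹ (s ▹ x)         ≈⟨ ▹-assoc (scal p) s x ⟨
    (scal p · s) ▹ x         ≈⟨ ▹-cong ps≈pτᴹ (≈ᵛ-refl {x}) ⟩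
    (scal p · τ) ▹ x         ≈⟨ ▹-assoc (scal p) τ x ⟩
    scal p ▹ (τ ▹ x)         ≈⟨ scal-▹ p (τ ▹ x) ⟩
    p ·ᵛ (τ ▹ x)             ∎
    where
    open Vect-Reasoning
    ps≈pτᴹ : (scal p · s) ≈ᴹ (scal p · τ)
    ps≈pτᴹ = ≈ᴹ-trans (λ i j → trans (sym (+-identityʳ _)) (+-congˡ (sym (trans (scal-· γ t i j) (trans (*-congʳ γ≈0) (zeroˡ _)))))) L.Fs+ct

  -- The vanishing of p.

  private
    -- After multiplication by p, the vector is some `σᵐv`. The exponent is left open because the
    -- recursion of `polyAct` replaces the vector w by `τw`, which raises it by one.
    Reduces : Vect → Set ℓ
    Reduces w = ∃ λ m → (p ·ᵛ w) ≈ᵛ (p ·ᵛ ((σ ^ᴹ m) ▹ v))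

    reduces-e* : ∀ {w} → Reduces w → p * ⟪ e*R , w ⟫ ≈ 0#
    reduces-e* {w} (m , eq) = begin
      p * ⟪ e*R , w ⟫                  ≈⟨ pair-·ʳ e*R p w ⟨
      ⟪ e*R , p ·ᵛ w ⟫                 ≈⟨ pair-cong {l = e*R} (λ _ → refl) eq ⟩
      ⟪ e*R , p ·ᵛ ((σ ^ᴹ m) ▹ v) ⟫    ≈⟨ pair-·ʳ e*R p ((σ ^ᴹ m) ▹ v) ⟩
      p * ⟪ e*R , (σ ^ᴹ m) ▹ v ⟫       ≈⟨ power m ⟩
      0#                               ∎
      where
      open Relation.Binary.Reasoning.Setoid setoid
      power : ∀ m → p * ⟪ e*R , (σ ^ᴹ m) ▹ v ⟫ ≈ 0#
      power zero    = trans (*-congˡ (pair-cong {l = e*R} (λ _ → refl) (▹-identity v))) pα≈0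
      power (suc m) = trans (*-congˡ (trans (sym (Σ-assoc e*R (σ · (σ ^ᴹ m)) v))
        (pair-0ˡ v (≈ᵛ-trans (≈ᵛ-sym (◃-assoc e*R σ (σ ^ᴹ m))) (0-◃ (σ ^ᴹ m) (e*-ᴴ τ)))))) (zeroʳ p)

    reduces-τ : ∀ {w} → Reduces w → Reduces (τ ▹ w)
    reduces-τ {w} (m , eq) = suc m , (begin
      p ·ᵛ (τ ▹ w)                   ≈⟨ ▹-·ᵛ τ p w ⟨
      τ ▹ (p ·ᵛ w)                   ≈⟨ ▹-cong (≈ᴹ-refl {τ}) eq ⟩
      τ ▹ (p ·ᵛ ((σ ^ᴹ m) ▹ v))      ≈⟨ ▹-·ᵛ τ p ((σ ^ᴹ m) ▹ v) ⟩
      p ·ᵛ (τ ▹ ((σ ^ᴹ m) ▹ v))      ≈⟨ ps≈pτ ((σ ^ᴹ m) ▹ v) ⟨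
      p ·ᵛ (s ▹ ((σ ^ᴹ m) ▹ v))      ≈⟨ (λ i → *-congˡ (proj₁ (proj₂ (proj₂ deformationσ)) m i)) ⟨
      p ·ᵛ ((σ ^ᴹ suc m) ▹ v)        ∎)
      where open Vect-Reasoning

    reduces-polyAct : ∀ q {w} → Reduces w → p * ⟪ e*R , polyAct q τ w ⟫ ≈ 0#
    reduces-polyAct []       r = trans (*-congˡ (pair-0ʳ e*R (λ _ → refl))) (zeroʳ p)
    reduces-polyAct (b ∷ bs) {w} r = begin
      p * ⟪ e*R , (b ·ᵛ w) +ᵛ polyAct bs τ (τ ▹ w) ⟫
        ≈⟨ *-congˡ (pair-+ʳ e*R (b ·ᵛ w) (polyAct bs τ (τ ▹ w))) ⟩
      p * (⟪ e*R , b ·ᵛ w ⟫ + ⟪ e*R , polyAct bs τ (τ ▹ w) ⟫)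
        ≈⟨ distribˡ _ _ _ ⟩
      p * ⟪ e*R , b ·ᵛ w ⟫ + p * ⟪ e*R , polyAct bs τ (τ ▹ w) ⟫
        ≈⟨ +-cong (trans (*-congˡ (pair-·ʳ e*R b w)) (trans (sym (*-assoc _ _ _)) (trans (*-congʳ (*-comm p b)) (*-assoc _ _ _))))
                  (reduces-polyAct bs (reduces-τ {w} r)) ⟩
      b * (p * ⟪ e*R , w ⟫) + 0#
        ≈⟨ trans (+-identityʳ _) (trans (*-congˡ (reduces-e* {w} r)) (zeroʳ b)) ⟩
      0# ∎
      where open Relation.Binary.Reasoning.Setoid setoid

  p≈0 : p ≈ 0#
  p≈0 =
    let q , qe≈te = proj₁ stable (t ▹ eR)
        qv≈e : polyAct q τ v ≈ᵛ eR
        qv≈e = ≈ᵛ-trans (polyAct-cong q (≈ᵛ-sym t′e≈v)) (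
          ≈ᵛ-trans (≈ᵛ-sym (equivariant-polyAct (commutes⇒equivariant t′-comm) q eR)) (
          ≈ᵛ-trans (▹-cong (≈ᴹ-refl {t′}) qe≈te) (
          ≈ᵛ-trans (≈ᵛ-sym (▹-assoc t′ t eR)) (
          ≈ᵛ-trans (▹-cong t′t≈1 (≈ᵛ-refl {eR})) (▹-identity eR)))))
    in trans (sym (*-identityʳ p)) (trans (*-congˡ (sym e*e≈1))
      (trans (*-congˡ (pair-cong {l = e*R} (λ _ → refl) (≈ᵛ-sym qv≈e)))
        (reduces-polyAct q {v} (0 , λ i → *-congˡ (sym (▹-identity v i))))))

  αβ≈1 : α * β ≈ 1#
  αβ≈1 = trans (sym (+-identityˡ _)) (trans (+-congʳ (sym p≈0)) p+αβ≈1)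

  private
    scal-αβ : (scal α · scal β) ≈ᴹ 1ᴹ
    scal-αβ = ≈ᴹ-trans (≈ᴹ-sym (scalar-* α β)) (≈ᴹ-trans (scalar-cong αβ≈1) scalar-1)

  v≈αe : v ≈ᵛ (α ·ᵛ eR)
  v≈αe i = begin
    v i                      ≈⟨ t′e≈v i ⟨
    (t′ ▹ eR) i              ≈⟨ *-identityˡ _ ⟨
    1# * (t′ ▹ eR) i         ≈⟨ *-congʳ αβ≈1 ⟨
    α * β * (t′ ▹ eR) i      ≈⟨ *-assoc _ _ _ ⟩
    α * (β * (t′ ▹ eR) i)    ≈⟨ *-congˡ (scal-▹ β (t′ ▹ eR) i) ⟨
    α * (scal β ▹ (t′ ▹ eR)) i ≈⟨ *-congˡ (▹-assoc (scal β) t′ eR i) ⟨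
    α * ((scal β · t′) ▹ eR) i ≈⟨ *-congˡ (▹-cong (≈ᴹ-trans I.Bt′≈AB scal-αβ) (≈ᵛ-refl {eR}) i) ⟩
    α * (1ᴹ ▹ eR) i          ≈⟨ *-congˡ (▹-identity eR i) ⟩
    α * eR i                 ∎
    where open Relation.Binary.Reasoning.Setoid setoid

  αl≈e* : (α ·ᵛ l) ≈ᵛ e*R
  αl≈e* = begin
    α ·ᵛ l                       ≈⟨ (λ j → *-congˡ (e*t≈l j)) ⟨
    α ·ᵛ (e*R ◃ t)               ≈⟨ ·ᵛ-◃ α e*R t ⟨
    (α ·ᵛ e*R) ◃ t               ≈⟨ ◃-cong (◃-scal e*R α) (≈ᴹ-refl {t}) ⟨
    (e*R ◃ scal α) ◃ t           ≈⟨ ◃-assoc e*R (scal α) t ⟩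
    e*R ◃ (scal α · t)           ≈⟨ ◃-cong (≈ᵛ-refl {e*R}) (≈ᴹ-trans I.At≈AB scal-αβ) ⟩
    e*R ◃ 1ᴹ                     ≈⟨ ◃-identity e*R ⟩
    e*R                          ∎
    where open Vect-Reasoning

  a∈HZ : InHZ a
  a∈HZ = h , scal β , ((h′ , hh′≈1 , h′h≈1) , he≈e , e*h≈e*) , (β , (α , trans (*-comm β α) αβ≈1) , ≈ᴹ-refl {scal β}) , a≈hz
    where
    h h′ : Mat
    h  = a · scal α
    h′ = scal β · a′

    scal-βα : (scal β · scal α) ≈ᴹ 1ᴹ
    scal-βα = ≈ᴹ-trans (scal-central β (scal α)) scal-αβ

    collapse : ∀ {x y z w} → (y · z) ≈ᴹ 1ᴹ → (x · w) ≈ᴹ 1ᴹ → ((x · y) · (z · w)) ≈ᴹ 1ᴹ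
    collapse {x} {y} {z} {w} yz≈1 xw≈1 = begin
      (x · y) · (z · w)   ≈⟨ ·-assoc x y (z · w) ⟩
      x · (y · (z · w))   ≈⟨ ·-cong (≈ᴹ-refl {x}) (·-assoc y z w) ⟨
      x · ((y · z) · w)   ≈⟨ ·-cong (≈ᴹ-refl {x}) (·-cong yz≈1 (≈ᴹ-refl {w})) ⟩
      x · (1ᴹ · w)        ≈⟨ ·-cong (≈ᴹ-refl {x}) (·-identityˡ w) ⟩
      x · w               ≈⟨ xw≈1 ⟩
      1ᴹ                  ∎
      where open Mat-Reasoning

    hh′≈1 : (h · h′) ≈ᴹ 1ᴹ
    hh′≈1 = collapse {a} {scal α} {scal β} {a′} scal-αβ aa′≈1

    h′h≈1 : (h′ · h) ≈ᴹ 1ᴹ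
    h′h≈1 = collapse {scal β} {a′} {a} {scal α} a′a≈1 scal-βα

    he≈e : (h ▹ eR) ≈ᵛ eR
    he≈e = begin
      (a · scal α) ▹ eR    ≈⟨ ▹-assoc a (scal α) eR ⟩
      a ▹ (scal α ▹ eR)    ≈⟨ ▹-cong (≈ᴹ-refl {a}) (≈ᵛ-trans (scal-▹ α eR) (≈ᵛ-sym v≈αe)) ⟩
      a ▹ (a′ ▹ eR)        ≈⟨ ▹-assoc a a′ eR ⟨
      (a · a′) ▹ eR        ≈⟨ ▹-cong aa′≈1 (≈ᵛ-refl {eR}) ⟩
      1ᴹ ▹ eR              ≈⟨ ▹-identity eR ⟩
      eR                   ∎
      where open Vect-Reasoning

    e*h≈e* : (e*R ◃ h) ≈ᵛ e*R
    e*h≈e* = ≈ᵛ-trans (≈ᵛ-sym (◃-assoc e*R a (scal α))) (≈ᵛ-trans (◃-scal l α) αl≈e*)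

    a≈hz : a ≈ᴹ (h · scal β)
    a≈hz = ≈ᴹ-sym (≈ᴹ-trans (·-assoc a (scal α) (scal β))
      (≈ᴹ-trans (·-cong (≈ᴹ-refl {a}) scal-αβ) (·-identityʳ a)))

theorem5p1 : {c ℓ : Level} (R : CommutativeRing c ℓ) (n : ℕ) (e e* : Fin n → ℤ) →
    ℤpair e* e ≡ + 1 →
    n ≥ 3 →
    LinAlg.IsUnit R n (CommutativeRing._+_ R (CommutativeRing.1# R) (CommutativeRing.1# R)) →
    (τ a : LinAlg.Mat R n) →
    LinAlg.WithE.Stable R n e e* τ →
    LinAlg.InG R n a →
    ((A : Algebra R c ℓ) (y : LinAlg.Mat (Algebra.ring A) n) →
    LinAlg.WithE.InX (Algebra.ring A) n e e* (baseMat A τ) (baseMat A a) y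
    ⇔ LinAlg.WithE.InHcent (Algebra.ring A) n e e* (LinAlg.WithE._ᴴ (Algebra.ring A) n e e* (baseMat A τ)) y) →
    LinAlg.WithE.InHZ R n e e* a
theorem5p1 R n e e* ℤe*e≡1 n≥3 _ τ a stable (a′ , aa′≈1 , a′a≈1) X⇔H =
  Rigidity.a∈HZ R n e e* e*e≈1 n≥3 τ a a′ stable aa′≈1 a′a≈1 (λ A y → Equivalence.from (X⇔H A y))
  where
  open CommutativeRing R
  open LinAlg R n
  e*e≈1 : ⟪ (λ i → fromℤ (e* i)) , (λ i → fromℤ (e i)) ⟫ ≈ 1#
  e*e≈1 = trans (sym (IntegerHomomorphism.fromℤ-pair R n e* e))
    (trans (reflexive (≡.cong fromℤ ℤe*e≡1)) (+-identityʳ 1#))
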